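{- Let $p\ge 5$ be a prime and let $a$ be a $p$-adic integer such that $\langle a\rangle_p$ is even. Then $$\sum_{k=0}^{p-1}\frac{(-a)_k\,(a+1)_k}{(1)_k}\cdot\frac{(1/2)^k}{k!}\equiv(-1)^{\frac{p+1}{2}}\,\Gamma_p\!\left(\tfrac{1}{2}\right)\Gamma_p\!\left(-\tfrac{a}{2}\right)\Gamma_p\!\left(\tfrac{a+1}{2}\right)\pmod{p^2}.$$ (The left-hand side is the truncated hypergeometric series ${}_2F_1\!\left(-a,\,a+1;\,1;\,\tfrac12\right)_{p-1}$.)
   Context: For a complex (or $p$-adic) number $x$, the Pochhammer symbol is $(x)_0=1$ and $(x)_k=x(x+1)\cdots(x+k-1)$ for $k\ge1$. For a $p$-adic integer $a$, $\langle a\rangle_p$ denotes the least non-negative integer $r$ with $a\equiv r\pmod p$. $\Gamma_p$ is Morita's $p$-adic Gamma function: for $x\in\mathbb{Z}_p$, $\Gamma_p(x)=\lim_{m\to x}(-1)^m\prod_{0<k<m,\ (k,p)=1}k$, the limit taken over non-negative integers $m$ tending to $x$ $p$-adically. Congruences modulo $p^2$ are in $\mathbb{Z}_p$. -}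

module Defs where

open import Data.Nat as ℕ using (ℕ; zero; suc; _<_; _^_; NonZero; _!)
open import Data.Nat.Properties using (m*n≢0; m^n≢0; _!≢0)
import Data.Nat.Divisibility as ℕD
open import Data.Integer as ℤ using (ℤ; +_; -_)
open import Data.Integer.Divisibility as ℤD using ()
open import Data.Rational as ℚ using (ℚ; ↥_; ↧ₙ_)
open import Data.Fin using (Fin; toℕ)
open import Relation.Nullary using (¬_; yes; no)
open import Data.Product using (_×_)

-- over ℤ (used for (-a)_k and (a+1)_k with a a natural approximation)
pochℤ : ℤ → ℕ → ℤ
pochℤ x zero    = + 1
pochℤ x (suc k) = pochℤ x k ℤ.* (x ℤ.+ + k)

pochℕ : ℕ → ℕ → ℕ
pochℕ x zero    = 1
pochℕ x (suc k) = pochℕ x k ℕ.* (x ℕ.+ k)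

poch1≢0 : ∀ k → NonZero (pochℕ 1 k)
poch1≢0 zero    = _
poch1≢0 (suc k) = m*n≢0 (pochℕ 1 k) (suc k) {{poch1≢0 k}}

den : ℕ → ℕ
den k = pochℕ 1 k ℕ.* 2 ^ k ℕ.* k !

den≢0 : ∀ k → NonZero (den k)
den≢0 k = m*n≢0 (pochℕ 1 k ℕ.* 2 ^ k) (k !)
  {{m*n≢0 (pochℕ 1 k) (2 ^ k) {{poch1≢0 k}} {{m^n≢0 2 k}}}} {{k !≢0}}

term : ℤ → ℕ → ℚ
term A k = (pochℤ (- A) k ℤ.* pochℤ (A ℤ.+ + 1) k ℚ./ den k) {{den≢0 k}}

sumTo : ℕ → (ℕ → ℚ) → ℚ
sumTo zero    f = ℚ.0ℚ
sumTo (suc n) f = sumTo n f ℚ.+ f n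

F-trunc : ℕ → ℤ → ℚ
F-trunc p A = sumTo p (term A)

-- Morita's p-adic Gamma on non-negative integers:
--   G p m = (-1)^m ∏_{0<k<m, p∤k} k

prodCoprime : ℕ → ℕ → ℤ
prodCoprime p zero    = + 1
prodCoprime p (suc m) with m | p ℕD.∣? m
... | zero  | _     = prodCoprime p m
... | suc j | yes _ = prodCoprime p m
... | suc j | no _  = prodCoprime p m ℤ.* + suc j

sgn : ℕ → ℤ
sgn zero    = + 1
sgn (suc m) = - sgn m

Gp : ℕ → ℕ → ℤ
Gp p m = sgn m ℤ.* prodCoprime p m

_≡_[modℤ_] : ℤ → ℤ → ℕ → Set
x ≡ y [modℤ n ] = (+ n) ℤD.∣ (x ℤ.- y)

-- x ≡ y (mod p^2) in ℤ_p, for rationals x, y: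
-- x - y = p^2 z with z ∈ ℤ_(p), i.e. (reduced) numerator divisible by p^2
-- and denominator prime to p.
_≡_[modℚ_²] : ℚ → ℚ → ℕ → Set
x ≡ y [modℚ p ²] =
  ((+ (p ^ 2)) ℤD.∣ (↥ (x ℚ.- y))) × (¬ (p ℕD.∣ (↧ₙ (x ℚ.- y))))

-- p-adic integers as compatible systems of residues a mod p^n

record ℤ[_] (p : ℕ) : Set where
  field
    res     : ℕ → ℕ
    res-lt  : ∀ n → res n < p ^ n
    res-coh : ∀ n → (+ res (suc n)) ≡ (+ res n) [modℤ p ^ n ]

⟨_⟩ : ∀ {p} → ℤ[ p ] → ℕ
⟨ a ⟩ = ℤ[_].res a 1

{-# OPTIONS --safe #-}

-- Everything takes place modulo p², with p = 2h + 1. Write V a for the truncated series at a, cleared of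
-- its denominator. A Zeilberger-type telescoping gives
--   (a+1)(a+2) [(a+2) V(a+2) + (a+1) V(a)] = − (2a+3) (−a−2)_p (a+1)_p ,
-- whose right-hand side vanishes mod p². By Γ_p(x+1) = − x Γ_p(x) the Gamma product obeys the same
-- two-step recurrence, so it suffices to treat a = p t. There both sides are affine in t mod p²:
--   * the series is affine with slope − p Σ 1/(k 2^k), which is Σ_{0<k<p} (−p)_k / (k! 2^k) mod p²; the
--     latter is evaluated by the binomial theorem (which also yields Fermat's little theorem);
--   * (p t + 1)_{p−1} ≡ (p−1)! for every t, so Γ_p at multiples of p is a power of − (p−1)!, a p-th root of
--     unity mod p² by Wilson's theorem; the remaining half blocks (p b + 1)_h, with 2b + 1 ≡ t, are
--     products of odd numbers ∏ (x + 2i + 1) at x = − p t, affine in t, whose values at x = 0 and x = p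
--     differ by the factor 2^{p−1}.

module Submission where

open import Defs

module Development where

  open import Data.Integer as ℤ using (ℤ; +_; -[1+_]; -_; _+_; _*_; _-_; _^_; NonZero; ≢-nonZero; ∣_∣)
  open import Data.Integer.DivMod using (_%ℕ_; _/ℕ_; a≡a%ℕn+[a/ℕn]*n)
  open import Data.Integer.Divisibility.Signed using (_∣_; divides; ∣ᵤ⇒∣; ∣⇒∣ᵤ; ∣m⇒∣-m; ∣n⇒∣m*n)
  open import Data.Integer.Properties using (*-assoc; *-comm; *-identityˡ; *-identityʳ; *-zeroˡ; *-cancelˡ-≡; abs-*; pos-*; +-injective; ^-zeroˡ; ^-distribˡ-+-*; ^-*-assoc; i^n≡0⇒i≡0)
  open import Data.Integer.Tactic.RingSolver using (solve-∀)
  open import Data.Nat as ℕ using (ℕ; zero; suc; _!)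
  import Data.Nat.Coprimality as Coprime
  import Data.Nat.DivMod as ℕ
  import Data.Nat.Divisibility as ℕ
  open import Data.Nat.Primality using (Prime; euclidsLemma; prime⇒nonZero; prime⇒irreducible)
  import Data.Nat.Properties as ℕ
  import Data.Nat.Tactic.RingSolver as ℕ
  open import Data.Product using (_×_; _,_; ∃)
  open import Data.Rational as ℚ using (ℚ; mkℚ; ↥_; ↧_; ↧ₙ_; toℚᵘ)
  open import Data.Rational.Properties using (toℚᵘ-homo-+; toℚᵘ-fromℚᵘ; ↥ᵘ-toℚᵘ; ↧ᵘ-toℚᵘ; ↥-neg; ↧-neg)
  open import Data.Rational.Unnormalised as ℚᵘ using (mkℚᵘ; *≡*)
  open import Data.Sum using (_⊎_; inj₁; inj₂)
  open import Level using (0ℓ)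
  open import Relation.Binary.Bundles using (Setoid)
  open import Relation.Binary.PropositionalEquality using (_≡_; _≢_; refl; sym; trans; cong; cong₂; subst; module ≡-Reasoning)
  import Relation.Binary.Reasoning.Setoid as SetoidReasoning
  open import Relation.Nullary using (¬_; Dec; yes; no; contradiction)


  -- The series cleared of denominators, and its two-step recurrence

  num : ℤ → ℕ → ℤ
  num a k = pochℤ (- a) k * pochℤ (a + + 1) k

  -- V a n / den n is the partial sum Σ_{k ≤ n} of the series at a.
  V : ℤ → ℕ → ℤ
  V a zero    = + 1
  V a (suc n) = V a n * (+ 2 * (+ suc n * + suc n)) + num a (suc n)

  poch-shift : ∀ x n → pochℤ x (suc n) ≡ x * pochℤ (x + + 1) n
  poch-shift x zero    = lem x
    where
    lem : ∀ x → + 1 * (x + + 0) ≡ x * + 1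
    lem = solve-∀
  poch-shift x (suc n) = trans (cong (_* (x + + suc n)) (poch-shift x n)) (lem x (pochℤ (x + + 1) n) (+ n))
    where
    lem : ∀ x y n → x * y * (x + (+ 1 + n)) ≡ x * (y * (x + + 1 + n))
    lem = solve-∀

  -- W a k divides both (a+1)(a+2) num a k and (a+1)(a+2) num (a+2) k, which is what makes the sum of the two telescope.
  W : ℤ → ℕ → ℤ
  W a k = pochℤ (- (a + + 2)) k * pochℤ (a + + 1) k

  -- Both sides are (x)_(n+2), with the first two factors split off on the left and the last two on
  -- the right.
  poch-shift₂ : ∀ x n → x * (x + + 1) * pochℤ (x + + 2) n ≡ pochℤ x n * (x + + n) * (x + + 1 + + n)
  poch-shift₂ x n = begin
    x * (x + + 1) * pochℤ (x + + 2) n         ≡⟨ *-assoc x _ _ ⟩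
    x * ((x + + 1) * pochℤ (x + + 2) n)       ≡⟨ cong (λ z → x * ((x + + 1) * pochℤ z n)) (lem₁ x) ⟩
    x * ((x + + 1) * pochℤ (x + + 1 + + 1) n) ≡⟨ cong (x *_) (poch-shift (x + + 1) n) ⟨
    x * pochℤ (x + + 1) (suc n)               ≡⟨ *-assoc x _ _ ⟨
    x * pochℤ (x + + 1) n * (x + + 1 + + n)   ≡⟨ cong (_* (x + + 1 + + n)) (poch-shift x n) ⟨
    pochℤ x (suc n) * (x + + 1 + + n)         ∎
    where
    open ≡-Reasoning
    lem₁ : ∀ x → x + + 2 ≡ x + + 1 + + 1
    lem₁ = solve-∀

  -- This is `poch-shift₂` at `- (a + + 2)`, where the two leading factors multiply to
  -- `(a + + 1) * (a + + 2)`. The lemma `num₂-as-W` uses it at `a + + 1` instead.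
  num-as-W : ∀ a k → (a + + 1) * (a + + 2) * num a k ≡ W a k * ((+ k - a - + 2) * (+ k - a - + 1))
  num-as-W a k = begin
    (a + + 1) * (a + + 2) * (pochℤ (- a) k * v)
      ≡⟨ lem₁ a (pochℤ (- a) k) v ⟩
    (- (a + + 2)) * (- (a + + 2) + + 1) * pochℤ (- a) k * v
      ≡⟨ cong (λ z → (- (a + + 2)) * (- (a + + 2) + + 1) * pochℤ z k * v) (lem₂ a) ⟩
    (- (a + + 2)) * (- (a + + 2) + + 1) * pochℤ (- (a + + 2) + + 2) k * v
      ≡⟨ cong (_* v) (poch-shift₂ (- (a + + 2)) k) ⟩
    u * (- (a + + 2) + + k) * (- (a + + 2) + + 1 + + k) * v
      ≡⟨ lem₃ a (+ k) u v ⟩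
    u * v * ((+ k - a - + 2) * (+ k - a - + 1)) ∎
    where
    open ≡-Reasoning
    u = pochℤ (- (a + + 2)) k
    v = pochℤ (a + + 1) k
    lem₁ : ∀ a x v → (a + + 1) * (a + + 2) * (x * v) ≡ (- (a + + 2)) * (- (a + + 2) + + 1) * x * v
    lem₁ = solve-∀
    lem₂ : ∀ a → - a ≡ - (a + + 2) + + 2
    lem₂ = solve-∀
    lem₃ : ∀ a k u v → u * (- (a + + 2) + k) * (- (a + + 2) + + 1 + k) * v ≡ u * v * ((k - a - + 2) * (k - a - + 1))
    lem₃ = solve-∀

  num₂-as-W : ∀ a k → (a + + 1) * (a + + 2) * num (a + + 2) k ≡ W a k * ((a + + 1 + + k) * (a + + 2 + + k))
  num₂-as-W a k = begin
    (a + + 1) * (a + + 2) * (u * pochℤ (a + + 2 + + 1) k)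
      ≡⟨ cong (λ z → (a + + 1) * (a + + 2) * (u * pochℤ z k)) (lem₂ a) ⟩
    (a + + 1) * (a + + 2) * (u * pochℤ (a + + 1 + + 2) k)
      ≡⟨ lem₁ a u (pochℤ (a + + 1 + + 2) k) ⟩
    (a + + 1) * (a + + 1 + + 1) * pochℤ (a + + 1 + + 2) k * u
      ≡⟨ cong (_* u) (poch-shift₂ (a + + 1) k) ⟩
    v * (a + + 1 + + k) * (a + + 1 + + 1 + + k) * u
      ≡⟨ lem₃ a (+ k) u v ⟩
    u * v * ((a + + 1 + + k) * (a + + 2 + + k)) ∎
    where
    open ≡-Reasoning
    u = pochℤ (- (a + + 2)) k
    v = pochℤ (a + + 1) k
    lem₁ : ∀ a u x → (a + + 1) * (a + + 2) * (u * x) ≡ (a + + 1) * (a + + 1 + + 1) * x * u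
    lem₁ = solve-∀
    lem₂ : ∀ a → a + + 2 + + 1 ≡ a + + 1 + + 2
    lem₂ = solve-∀
    lem₃ : ∀ a k u v → v * (a + + 1 + k) * (a + + 1 + + 1 + k) * u ≡ u * v * ((a + + 1 + k) * (a + + 2 + k))
    lem₃ = solve-∀

  -- The right-hand side is a closed form for the partial sums of the combination, so induction on
  -- `n` suffices: once both new numerators are expressed through `W a (suc n)`, the inductive step
  -- is a polynomial identity in `a` and `k`.
  V-recurrence : ∀ a n →
    (a + + 1) * (a + + 2) * ((a + + 2) * V (a + + 2) n + (a + + 1) * V a n) ≡ - (+ 2 * a + + 3) * W a (suc n)
  V-recurrence a zero = lem a
    where
    lem : ∀ a → (a + + 1) * (a + + 2) * ((a + + 2) * + 1 + (a + + 1) * + 1) ≡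
          - (+ 2 * a + + 3) * (+ 1 * (- (a + + 2) + + 0) * (+ 1 * (a + + 1 + + 0)))
    lem = solve-∀
  V-recurrence a (suc n) = begin
    c * ((a + + 2) * (V (a + + 2) n * (+ 2 * (k * k)) + num (a + + 2) (suc n)) + (a + + 1) * (V a n * (+ 2 * (k * k)) + num a (suc n)))
      ≡⟨ lem₁ a k (V (a + + 2) n) (V a n) (num (a + + 2) (suc n)) (num a (suc n)) ⟩
    c * ((a + + 2) * V (a + + 2) n + (a + + 1) * V a n) * (+ 2 * (k * k))
      + ((a + + 2) * (c * num (a + + 2) (suc n)) + (a + + 1) * (c * num a (suc n)))
      ≡⟨ cong₂ _+_ (cong (_* (+ 2 * (k * k))) (V-recurrence a n))
           (cong₂ (λ x y → (a + + 2) * x + (a + + 1) * y) (num₂-as-W a (suc n)) (num-as-W a (suc n))) ⟩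
    - (+ 2 * a + + 3) * W a (suc n) * (+ 2 * (k * k))
      + ((a + + 2) * (W a (suc n) * ((a + + 1 + k) * (a + + 2 + k))) + (a + + 1) * (W a (suc n) * ((k - a - + 2) * (k - a - + 1))))
      ≡⟨ lem₂ a k (pochℤ (- (a + + 2)) (suc n)) (pochℤ (a + + 1) (suc n)) ⟩
    - (+ 2 * a + + 3) * W a (suc (suc n)) ∎
    where
    open ≡-Reasoning
    c = (a + + 1) * (a + + 2)
    k = + suc n
    lem₁ : ∀ a k x y p q →
      (a + + 1) * (a + + 2) * ((a + + 2) * (x * (+ 2 * (k * k)) + p) + (a + + 1) * (y * (+ 2 * (k * k)) + q)) ≡
      (a + + 1) * (a + + 2) * ((a + + 2) * x + (a + + 1) * y) * (+ 2 * (k * k))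
        + ((a + + 2) * ((a + + 1) * (a + + 2) * p) + (a + + 1) * ((a + + 1) * (a + + 2) * q))
    lem₁ = solve-∀
    lem₂ : ∀ a k u v →
      - (+ 2 * a + + 3) * (u * v) * (+ 2 * (k * k))
        + ((a + + 2) * (u * v * ((a + + 1 + k) * (a + + 2 + k))) + (a + + 1) * (u * v * ((k - a - + 2) * (k - a - + 1)))) ≡
      - (+ 2 * a + + 3) * (u * (- (a + + 2) + k) * (v * (a + + 1 + k)))
    lem₂ = solve-∀

  -- Splitting, reflection and zeros of Pochhammer symbols

  poch-split : ∀ x m n → pochℤ x (m ℕ.+ n) ≡ pochℤ x m * pochℤ (x + + m) n
  poch-split x m zero    = trans (cong (pochℤ x) (ℕ.+-identityʳ m)) (sym (*-identityʳ _))
  poch-split x m (suc n) = begin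
    pochℤ x (m ℕ.+ suc n)                            ≡⟨ cong (pochℤ x) (ℕ.+-suc m n) ⟩
    pochℤ x (m ℕ.+ n) * (x + (+ m + + n))            ≡⟨ cong (_* (x + (+ m + + n))) (poch-split x m n) ⟩
    pochℤ x m * pochℤ (x + + m) n * (x + (+ m + + n)) ≡⟨ lem (pochℤ x m) (pochℤ (x + + m) n) x (+ m) (+ n) ⟩
    pochℤ x m * pochℤ (x + + m) (suc n)              ∎
    where
    open ≡-Reasoning
    lem : ∀ u v x m n → u * v * (x + (m + n)) ≡ u * (v * (x + m + n))
    lem = solve-∀

  -- The factors on the left are those of `pochℤ (x + + 1) n`, negated and in reverse order.
  poch-reflect : ∀ x n → pochℤ (- (x + + n)) n ≡ sgn n * pochℤ (x + + 1) n
  poch-reflect x zero    = refl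
  poch-reflect x (suc n) = begin
    pochℤ (- (x + + suc n)) (suc n)                          ≡⟨ poch-shift (- (x + + suc n)) n ⟩
    - (x + + suc n) * pochℤ (- (x + + suc n) + + 1) n        ≡⟨ cong (λ z → - (x + + suc n) * pochℤ z n) (lem₁ x (+ n)) ⟩
    - (x + + suc n) * pochℤ (- (x + + n)) n                  ≡⟨ cong (- (x + + suc n) *_) (poch-reflect x n) ⟩
    - (x + + suc n) * (sgn n * pochℤ (x + + 1) n)            ≡⟨ lem₂ x (+ n) (sgn n) (pochℤ (x + + 1) n) ⟩
    - sgn n * (pochℤ (x + + 1) n * (x + + 1 + + n))          ∎
    where
    open ≡-Reasoning
    lem₁ : ∀ x n → - (x + (+ 1 + n)) + + 1 ≡ - (x + n)
    lem₁ = solve-∀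
    lem₂ : ∀ x n s u → - (x + (+ 1 + n)) * (s * u) ≡ - s * (u * (x + + 1 + n))
    lem₂ = solve-∀

  +suc! : ∀ n → + (suc n !) ≡ + suc n * + (n !)
  +suc! n = pos-* (suc n) (n !)

  poch-one : ∀ n → pochℤ (+ 1) n ≡ + (n !)
  poch-one zero    = refl
  poch-one (suc n) = begin
    pochℤ (+ 1) n * + suc n ≡⟨ cong (_* + suc n) (poch-one n) ⟩
    + (n !) * + suc n       ≡⟨ *-comm (+ (n !)) (+ suc n) ⟩
    + suc n * + (n !)       ≡⟨ +suc! n ⟨
    + (suc n !)             ∎
    where
    open ≡-Reasoning

  poch-neg : ∀ n → pochℤ (- (+ n)) n ≡ sgn n * + (n !)
  poch-neg n = trans (poch-reflect (+ 0) n) (cong (sgn n *_) (poch-one n))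

  -- The factor of index `m` is zero; splitting after `suc m` factors isolates it.
  poch-neg-vanishes : ∀ m d → pochℤ (- (+ m)) (suc (m ℕ.+ d)) ≡ + 0
  poch-neg-vanishes m d = begin
    pochℤ (- (+ m)) (suc (m ℕ.+ d))                             ≡⟨ cong (λ z → pochℤ (- (+ m)) (suc z)) (ℕ.+-comm m d) ⟩
    pochℤ (- (+ m)) (suc (d ℕ.+ m))                             ≡⟨ cong (pochℤ (- (+ m))) (ℕ.+-suc d m ) ⟨
    pochℤ (- (+ m)) (d ℕ.+ suc m)                               ≡⟨ cong (pochℤ (- (+ m))) (ℕ.+-comm d (suc m)) ⟩
    pochℤ (- (+ m)) (suc m ℕ.+ d)                               ≡⟨ poch-split (- (+ m)) (suc m) d ⟩
    pochℤ (- (+ m)) m * (- (+ m) + + m) * pochℤ (- (+ m) + + suc m) d ≡⟨ lem (pochℤ (- (+ m)) m) (+ m) _ ⟩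
    + 0 ∎
    where
    open ≡-Reasoning
    lem : ∀ u m v → u * (- m + m) * v ≡ + 0
    lem = solve-∀

  -- Truncated binomial expansions

  -- B x y n = n! y^n Σ_{k ≤ n} (−x)_k / (k! y^k), the truncated binomial expansion of (1 − 1/y)^x.
  B : ℤ → ℤ → ℕ → ℤ
  B x y zero    = + 1
  B x y (suc n) = B x y n * (y * + suc n) + pochℤ (- x) (suc n)

  -- Multiplying the expansion of (1 - 1/y)^x by 1 - 1/y gives that of (1 - 1/y)^(x+1), except at
  -- the truncation, where the last summand is left over as a boundary term.
  B-step : ∀ x y n → y * B (x + + 1) y n ≡ (y - + 1) * B x y n + pochℤ (- x) n
  B-step x y zero    = lem y
    where
    lem : ∀ y → y * + 1 ≡ (y - + 1) * + 1 + + 1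
    lem = solve-∀
  B-step x y (suc n) = begin
    y * (B (x + + 1) y n * (y * + suc n) + pochℤ (- (x + + 1)) (suc n))
      ≡⟨ lem₁ y (B (x + + 1) y n) (+ n) (pochℤ (- (x + + 1)) (suc n)) ⟩
    y * B (x + + 1) y n * (y * + suc n) + y * pochℤ (- (x + + 1)) (suc n)
      ≡⟨ cong₂ (λ u v → u * (y * + suc n) + y * v) (B-step x y n) (poch-shift (- (x + + 1)) n) ⟩
    ((y - + 1) * B x y n + pochℤ (- x) n) * (y * + suc n) + y * (- (x + + 1) * pochℤ (- (x + + 1) + + 1) n)
      ≡⟨ cong (λ z → ((y - + 1) * B x y n + pochℤ (- x) n) * (y * + suc n) + y * (- (x + + 1) * pochℤ z n)) (lem₂ x) ⟩
    ((y - + 1) * B x y n + pochℤ (- x) n) * (y * + suc n) + y * (- (x + + 1) * pochℤ (- x) n)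
      ≡⟨ lem₃ x y (+ n) (B x y n) (pochℤ (- x) n) ⟩
    (y - + 1) * B x y (suc n) + pochℤ (- x) (suc n) ∎
    where
    open ≡-Reasoning
    lem₁ : ∀ y b n z → y * (b * (y * (+ 1 + n)) + z) ≡ y * b * (y * (+ 1 + n)) + y * z
    lem₁ = solve-∀
    lem₂ : ∀ x → - (x + + 1) + + 1 ≡ - x
    lem₂ = solve-∀
    lem₃ : ∀ x y n b u → ((y - + 1) * b + u) * (y * (+ 1 + n)) + y * (- (x + + 1) * u) ≡
           (y - + 1) * (b * (y * (+ 1 + n)) + u * (- x + n)) + u * (- x + n)
    lem₃ = solve-∀

  B-zero : ∀ y n → B (+ 0) y n ≡ + (n !) * y ^ n
  B-zero y zero    = refl
  B-zero y (suc n) = begin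
    B (+ 0) y n * (y * + suc n) + pochℤ (+ 0) (suc n)        ≡⟨ cong₂ (λ u v → u * (y * + suc n) + v) (B-zero y n) (poch-shift (+ 0) n) ⟩
    + (n !) * y ^ n * (y * + suc n) + + 0 * pochℤ (+ 1) n    ≡⟨ lem (+ (n !)) (y ^ n) y (+ n) (pochℤ (+ 1) n) ⟩
    + suc n * + (n !) * (y * y ^ n)                          ≡⟨ cong (_* (y * y ^ n)) (+suc! n) ⟨
    + (suc n !) * y ^ suc n                                  ∎
    where
    open ≡-Reasoning
    lem : ∀ f z y n u → f * z * (y * (+ 1 + n)) + + 0 * u ≡ (+ 1 + n) * f * (y * z)
    lem = solve-∀

  -- The binomial theorem: `B-step` is iterated from `B-zero`, and no boundary term survives while
  -- the exponent stays within the truncation.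
  B-below : ∀ y m d → y ^ m * B (+ m) y (m ℕ.+ d) ≡ (y - + 1) ^ m * (+ ((m ℕ.+ d) !) * y ^ (m ℕ.+ d))
  B-below y zero    d = cong (+ 1 *_) (B-zero y d)
  B-below y (suc m) d = begin
    y * y ^ m * B (+ suc m) y n          ≡⟨ cong (λ z → y * y ^ m * B z y n) (lem₀ (+ m)) ⟩
    y * y ^ m * B (+ m + + 1) y n        ≡⟨ lem₁ y (y ^ m) (B (+ m + + 1) y n) ⟩
    y ^ m * (y * B (+ m + + 1) y n)      ≡⟨ cong (y ^ m *_) (B-step (+ m) y n) ⟩
    y ^ m * ((y - + 1) * B (+ m) y n + pochℤ (- (+ m)) n)
      ≡⟨ cong (λ z → y ^ m * ((y - + 1) * B (+ m) y n + z)) (poch-neg-vanishes m d) ⟩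
    y ^ m * ((y - + 1) * B (+ m) y n + + 0) ≡⟨ lem₂ (y ^ m) (y - + 1) (B (+ m) y n) ⟩
    (y - + 1) * (y ^ m * B (+ m) y n)
      -- The truncation index stays fixed: as the exponent drops by one, the excess `d` rises by
      -- one.
      ≡⟨ cong (λ z → (y - + 1) * (y ^ m * B (+ m) y z)) (ℕ.+-suc m d) ⟨
    (y - + 1) * (y ^ m * B (+ m) y (m ℕ.+ suc d))
      ≡⟨ cong ((y - + 1) *_) (B-below y m (suc d)) ⟩
    (y - + 1) * ((y - + 1) ^ m * (+ ((m ℕ.+ suc d) !) * y ^ (m ℕ.+ suc d)))
      ≡⟨ *-assoc (y - + 1) _ _ ⟨
    (y - + 1) ^ suc m * (+ ((m ℕ.+ suc d) !) * y ^ (m ℕ.+ suc d))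
      ≡⟨ cong (λ z → (y - + 1) ^ suc m * (+ (z !) * y ^ z)) (ℕ.+-suc m d) ⟩
    (y - + 1) ^ suc m * (+ (n !) * y ^ n) ∎
    where
    open ≡-Reasoning
    n = suc m ℕ.+ d
    lem₀ : ∀ m → + 1 + m ≡ m + + 1
    lem₀ = solve-∀
    lem₁ : ∀ y z b → y * z * b ≡ z * (y * b)
    lem₁ = solve-∀
    lem₂ : ∀ y z b → y * (z * b + + 0) ≡ z * (y * b)
    lem₂ = solve-∀

  B-diagonal : ∀ k n → B (+ n) (+ suc k) n ≡ (+ suc k - + 1) ^ n * + (n !)
  B-diagonal k n = *-cancelˡ-≡ (y ^ n) _ _ {{≢-nonZero y^n≢0}} (begin
    y ^ n * B (+ n) y n                    ≡⟨ cong (λ z → y ^ n * B (+ n) y z) (ℕ.+-identityʳ n) ⟨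
    y ^ n * B (+ n) y (n ℕ.+ 0)            ≡⟨ B-below y n 0 ⟩
    (y - + 1) ^ n * (+ ((n ℕ.+ 0) !) * y ^ (n ℕ.+ 0)) ≡⟨ cong (λ z → (y - + 1) ^ n * (+ (z !) * y ^ z)) (ℕ.+-identityʳ n) ⟩
    (y - + 1) ^ n * (+ (n !) * y ^ n)      ≡⟨ lem ((y - + 1) ^ n) (+ (n !)) (y ^ n) ⟩
    y ^ n * ((y - + 1) ^ n * + (n !))      ∎)
    where
    open ≡-Reasoning
    y = + suc k
    y^n≢0 : y ^ n ≢ + 0
    y^n≢0 eq with () ← i^n≡0⇒i≡0 y n eq
    lem : ∀ a b c → a * (b * c) ≡ c * (a * b)
    lem = solve-∀

  -- Here the truncation omits exactly the last summand of the full binomial expansion, which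
  -- accounts for `sgn n`. At n = p - 1 this evaluates `B (+ p) y n`, the source both of Fermat's
  -- theorem and of the slope of the series.
  B-above-diagonal : ∀ k n → + suc k * B (+ suc n) (+ suc k) n ≡ ((+ suc k - + 1) ^ suc n + sgn n) * + (n !)
  B-above-diagonal k n = begin
    y * B (+ suc n) y n                              ≡⟨ cong (λ z → y * B z y n) (lem₀ (+ n)) ⟩
    y * B (+ n + + 1) y n                            ≡⟨ B-step (+ n) y n ⟩
    (y - + 1) * B (+ n) y n + pochℤ (- (+ n)) n      ≡⟨ cong₂ (λ u v → (y - + 1) * u + v) (B-diagonal k n) (poch-neg n) ⟩
    (y - + 1) * ((y - + 1) ^ n * + (n !)) + sgn n * + (n !) ≡⟨ lem (y - + 1) ((y - + 1) ^ n) (+ (n !)) (sgn n) ⟩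
    ((y - + 1) ^ suc n + sgn n) * + (n !) ∎
    where
    open ≡-Reasoning
    y = + suc k
    lem₀ : ∀ m → + 1 + m ≡ m + + 1
    lem₀ = solve-∀
    lem : ∀ z u f s → z * (u * f) + s * f ≡ (z * u + s) * f
    lem = solve-∀

  -- Products with step two

  -- This is 2^n ((x+1)/2)_n, a Pochhammer symbol at half-integers kept integral.
  oddProd : ℤ → ℕ → ℤ
  oddProd x zero    = + 1
  oddProd x (suc n) = oddProd x n * (x + (+ 2 * + n + + 1))

  oddProd-poch : ∀ y n → (+ 2) ^ n * pochℤ y n ≡ oddProd (+ 2 * y - + 1) n
  oddProd-poch y zero    = refl
  oddProd-poch y (suc n) = begin
    + 2 * (+ 2) ^ n * (pochℤ y n * (y + + n))                    ≡⟨ lem ((+ 2) ^ n) (pochℤ y n) y (+ n) ⟩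
    (+ 2) ^ n * pochℤ y n * (+ 2 * y - + 1 + (+ 2 * + n + + 1))  ≡⟨ cong (_* (+ 2 * y - + 1 + (+ 2 * + n + + 1))) (oddProd-poch y n) ⟩
    oddProd (+ 2 * y - + 1) (suc n)                              ∎
    where
    open ≡-Reasoning
    lem : ∀ z u y n → + 2 * z * (u * (y + n)) ≡ z * u * (+ 2 * y - + 1 + (+ 2 * n + + 1))
    lem = solve-∀

  oddProd-shift : ∀ x n → oddProd x (suc n) ≡ (x + + 1) * oddProd (x + + 2) n
  oddProd-shift x zero    = lem x
    where
    lem : ∀ x → + 1 * (x + (+ 2 * + 0 + + 1)) ≡ (x + + 1) * + 1
    lem = solve-∀
  oddProd-shift x (suc n) = begin
    oddProd x (suc n) * (x + (+ 2 * + suc n + + 1))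
      ≡⟨ cong (_* (x + (+ 2 * + suc n + + 1))) (oddProd-shift x n) ⟩
    (x + + 1) * oddProd (x + + 2) n * (x + (+ 2 * + suc n + + 1))
      ≡⟨ lem x (oddProd (x + + 2) n) (+ n) ⟩
    (x + + 1) * (oddProd (x + + 2) n * (x + + 2 + (+ 2 * + n + + 1))) ∎
    where
    open ≡-Reasoning
    lem : ∀ x u n → (x + + 1) * u * (x + (+ 2 * (+ 1 + n) + + 1)) ≡ (x + + 1) * (u * (x + + 2 + (+ 2 * n + + 1)))
    lem = solve-∀

  -- Reversing the order, each factor x - 2n + 2i + 1 is the negative of -x + 2(n - 1 - i) + 1.
  oddProd-reflect : ∀ x n → oddProd (x - + 2 * + n) n ≡ sgn n * oddProd (- x) n
  oddProd-reflect x zero    = refl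
  oddProd-reflect x (suc n) = begin
    oddProd (x - + 2 * + suc n) (suc n)
      ≡⟨ oddProd-shift (x - + 2 * + suc n) n ⟩
    (x - + 2 * + suc n + + 1) * oddProd (x - + 2 * + suc n + + 2) n
      ≡⟨ cong (λ z → (x - + 2 * + suc n + + 1) * oddProd z n) (lem₁ x (+ n)) ⟩
    (x - + 2 * + suc n + + 1) * oddProd (x - + 2 * + n) n
      ≡⟨ cong ((x - + 2 * + suc n + + 1) *_) (oddProd-reflect x n) ⟩
    (x - + 2 * + suc n + + 1) * (sgn n * oddProd (- x) n)
      ≡⟨ lem₂ x (+ n) (sgn n) (oddProd (- x) n) ⟩
    - sgn n * (oddProd (- x) n * (- x + (+ 2 * + n + + 1))) ∎
    where
    open ≡-Reasoning
    lem₁ : ∀ x n → x - + 2 * (+ 1 + n) + + 2 ≡ x - + 2 * n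
    lem₁ = solve-∀
    lem₂ : ∀ x n s u → (x - + 2 * (+ 1 + n) + + 1) * (s * u) ≡ - s * (u * (- x + (+ 2 * n + + 1)))
    lem₂ = solve-∀

  -- The odd factors (2n - 1)!! and the even factors 2^n n! together make up (2n)!.
  oddProd-zero : ∀ n → oddProd (+ 0) n * ((+ 2) ^ n * + (n !)) ≡ + ((n ℕ.+ n) !)
  oddProd-zero zero    = refl
  oddProd-zero (suc n) = begin
    oddProd (+ 0) n * (+ 0 + (+ 2 * + n + + 1)) * (+ 2 * (+ 2) ^ n * + (suc n !))
      ≡⟨ cong (λ z → oddProd (+ 0) n * (+ 0 + (+ 2 * + n + + 1)) * (+ 2 * (+ 2) ^ n * z)) (+suc! n) ⟩
    oddProd (+ 0) n * (+ 0 + (+ 2 * + n + + 1)) * (+ 2 * (+ 2) ^ n * (+ suc n * + (n !)))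
      ≡⟨ lem (oddProd (+ 0) n) (+ n) ((+ 2) ^ n) (+ (n !)) ⟩
    (+ 1 + (+ 1 + (+ n + + n))) * ((+ 1 + (+ n + + n)) * (oddProd (+ 0) n * ((+ 2) ^ n * + (n !))))
      ≡⟨ cong (λ z → + suc (suc (n ℕ.+ n)) * (+ suc (n ℕ.+ n) * z)) (oddProd-zero n) ⟩
    + suc (suc (n ℕ.+ n)) * (+ suc (n ℕ.+ n) * + ((n ℕ.+ n) !))
      ≡⟨ cong (+ suc (suc (n ℕ.+ n)) *_) (+suc! (n ℕ.+ n)) ⟨
    + suc (suc (n ℕ.+ n)) * + (suc (n ℕ.+ n) !)
      ≡⟨ +suc! (suc (n ℕ.+ n)) ⟨
    + (suc (suc (n ℕ.+ n)) !)
      ≡⟨ cong (λ z → + (suc z !)) (ℕ.+-suc n n) ⟨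
    + ((suc n ℕ.+ suc n) !) ∎
    where
    open ≡-Reasoning
    lem : ∀ u n e f → u * (+ 0 + (+ 2 * n + + 1)) * (+ 2 * e * ((+ 1 + n) * f)) ≡
          (+ 1 + (+ 1 + (n + n))) * ((+ 1 + (n + n)) * (u * (e * f)))
    lem = solve-∀

  -- All factors are even here, so the product is 2^n (n+1)_n = 2^n (2n)!/n!, and `oddProd-zero`
  -- rewrites (2n)!. For n = h this is the value at x = p.
  oddProd-at-2n+1 : ∀ n → oddProd (+ suc (n ℕ.+ n)) n ≡ (+ 2) ^ (n ℕ.+ n) * oddProd (+ 0) n
  oddProd-at-2n+1 n = *-cancelˡ-≡ (+ (n !)) _ _ {{n ℕ.!≢0}} (begin
    + (n !) * oddProd (+ suc (n ℕ.+ n)) n              ≡⟨ cong (λ z → + (n !) * oddProd z n) (lem₁ (+ n)) ⟩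
    + (n !) * oddProd (+ 2 * + suc n - + 1) n          ≡⟨ cong₂ _*_ (poch-one n) (oddProd-poch (+ suc n) n) ⟨
    pochℤ (+ 1) n * (c * pochℤ (+ suc n) n)            ≡⟨ lem₂ (pochℤ (+ 1) n) c (pochℤ (+ suc n) n) ⟩
    c * (pochℤ (+ 1) n * pochℤ (+ suc n) n)            ≡⟨ cong (c *_) (poch-split (+ 1) n n) ⟨
    c * pochℤ (+ 1) (n ℕ.+ n)                          ≡⟨ cong (c *_) (poch-one (n ℕ.+ n)) ⟩
    c * + ((n ℕ.+ n) !)                                ≡⟨ cong (c *_) (oddProd-zero n) ⟨
    c * (oddProd (+ 0) n * (c * + (n !)))              ≡⟨ lem₃ c (oddProd (+ 0) n) (+ (n !)) ⟩
    + (n !) * (c * c * oddProd (+ 0) n)                ≡⟨ cong (λ z → + (n !) * (z * oddProd (+ 0) n)) (^-distribˡ-+-* (+ 2) n n) ⟨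
    + (n !) * ((+ 2) ^ (n ℕ.+ n) * oddProd (+ 0) n)    ∎)
    where
    open ≡-Reasoning
    c = (+ 2) ^ n
    lem₁ : ∀ n → + 1 + (n + n) ≡ + 2 * (+ 1 + n) - + 1
    lem₁ = solve-∀
    lem₂ : ∀ a c b → a * (c * b) ≡ c * (a * b)
    lem₂ = solve-∀
    lem₃ : ∀ c k f → c * (k * (c * f)) ≡ f * (c * c * k)
    lem₃ = solve-∀

  -- Congruences modulo an integer, modulo p and modulo p²

  module Congruence (q : ℤ) where

    infix 4 _≈_
    -- The quotient is an explicit witness and `x` stands alone on its side, so matching `equality`
    -- on `refl` eliminates `x` and each closure law becomes a ring identity.
    record _≈_ (x y : ℤ) : Set where
      constructor mod
      field
        multiple : ℤ
        equality : x ≡ y + multiple * q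

    ≡⇒≈ : ∀ {x y} → x ≡ y → x ≈ y
    ≡⇒≈ {x} refl = mod (+ 0) (lem x q)
      where
      lem : ∀ x q → x ≡ x + + 0 * q
      lem = solve-∀

    ≈-refl : ∀ {x} → x ≈ x
    ≈-refl = ≡⇒≈ refl

    ≈-sym : ∀ {x y} → x ≈ y → y ≈ x
    ≈-sym {x} {y} (mod k refl) = mod (- k) (lem y k q)
      where
      lem : ∀ y k q → y ≡ y + k * q + - k * q
      lem = solve-∀

    ≈-trans : ∀ {x y z} → x ≈ y → y ≈ z → x ≈ z
    ≈-trans {z = z} (mod k refl) (mod l refl) = mod (l + k) (lem z k l q)
      where
      lem : ∀ z k l q → z + l * q + k * q ≡ z + (l + k) * q
      lem = solve-∀

    +-cong : ∀ {x y u v} → x ≈ y → u ≈ v → x + u ≈ y + v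
    +-cong {y = y} {v = v} (mod k refl) (mod l refl) = mod (k + l) (lem y v k l q)
      where
      lem : ∀ y v k l q → y + k * q + (v + l * q) ≡ y + v + (k + l) * q
      lem = solve-∀

    *-cong : ∀ {x y u v} → x ≈ y → u ≈ v → x * u ≈ y * v
    *-cong {y = y} {v = v} (mod k refl) (mod l refl) = mod (k * v + y * l + k * l * q) (lem y v k l q)
      where
      lem : ∀ y v k l q → (y + k * q) * (v + l * q) ≡ y * v + (k * v + y * l + k * l * q) * q
      lem = solve-∀

    +-congˡ : ∀ x {u v} → u ≈ v → x + u ≈ x + v
    +-congˡ x = +-cong (≈-refl {x})

    +-congʳ : ∀ x {u v} → u ≈ v → u + x ≈ v + x
    +-congʳ x u≈v = +-cong u≈v (≈-refl {x})

    *-congˡ : ∀ x {u v} → u ≈ v → x * u ≈ x * v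
    *-congˡ x = *-cong (≈-refl {x})

    *-congʳ : ∀ x {u v} → u ≈ v → u * x ≈ v * x
    *-congʳ x u≈v = *-cong u≈v (≈-refl {x})

    neg-cong : ∀ {x y} → x ≈ y → - x ≈ - y
    neg-cong {y = y} (mod k refl) = mod (- k) (lem y k q)
      where
      lem : ∀ y k q → - (y + k * q) ≡ - y + - k * q
      lem = solve-∀

    ^-cong : ∀ {x y} n → x ≈ y → x ^ n ≈ y ^ n
    ^-cong zero    x≈y = ≈-refl
    ^-cong (suc n) x≈y = *-cong x≈y (^-cong n x≈y)

    poch-cong : ∀ {x y} n → x ≈ y → pochℤ x n ≈ pochℤ y n
    poch-cong zero    x≈y = ≈-refl
    poch-cong (suc n) x≈y = *-cong (poch-cong n x≈y) (+-congʳ (+ n) x≈y)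

    oddProd-cong : ∀ {x y} n → x ≈ y → oddProd x n ≈ oddProd y n
    oddProd-cong zero    x≈y = ≈-refl
    oddProd-cong (suc n) x≈y = *-cong (oddProd-cong n x≈y) (+-congʳ (+ 2 * + n + + 1) x≈y)

    ≈0⇒∣ : ∀ {x} → x ≈ + 0 → q ∣ x
    ≈0⇒∣ (mod k refl) = divides k (lem k q)
      where
      lem : ∀ k q → + 0 + k * q ≡ k * q
      lem = solve-∀

    ≈⇒∣ : ∀ {x y} → x ≈ y → q ∣ x - y
    ≈⇒∣ {y = y} (mod k refl) = divides k (lem y k q)
      where
      lem : ∀ y k q → y + k * q - y ≡ k * q
      lem = solve-∀

    ∣⇒≈ : ∀ {x y} → q ∣ x - y → x ≈ y
    ∣⇒≈ {x} {y} (divides k eq) = mod (k) (trans (lem x y) (cong (λ z → y + z) eq))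
      where
      lem : ∀ x y → x ≡ y + (x - y)
      lem = solve-∀

    setoid : Setoid 0ℓ 0ℓ
    setoid = record
      { Carrier       = ℤ
      ; _≈_           = _≈_
      ; isEquivalence = record { refl = ≈-refl ; sym = ≈-sym ; trans = ≈-trans }
      }

    module ≈-Reasoning = SetoidReasoning setoid

  module PrimeModulus (p : ℕ) (p-prime : Prime p) where

    private instance
      p≢0 : ℕ.NonZero p
      p≢0 = prime⇒nonZero p-prime

    module Mod-p  = Congruence (+ p)
    module Mod-p² = Congruence (+ p * + p)

    p∤-* : ∀ {x y} → ¬ (+ p ∣ x) → ¬ (+ p ∣ y) → ¬ (+ p ∣ x * y)
    p∤-* {x} {y} p∤x p∤y p∣xy
      with euclidsLemma ∣ x ∣ ∣ y ∣ p-prime (subst (p ℕ.∣_) (abs-* x y) (∣⇒∣ᵤ p∣xy))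
    ... | inj₁ p∣x = p∤x (∣ᵤ⇒∣ p∣x)
    ... | inj₂ p∣y = p∤y (∣ᵤ⇒∣ p∣y)

    p∣*⇒p∣ʳ : ∀ {x y} → ¬ (+ p ∣ x) → + p ∣ x * y → + p ∣ y
    p∣*⇒p∣ʳ {x} {y} p∤x p∣xy
      with euclidsLemma ∣ x ∣ ∣ y ∣ p-prime (subst (p ℕ.∣_) (abs-* x y) (∣⇒∣ᵤ p∣xy))
    ... | inj₁ p∣x = contradiction (∣ᵤ⇒∣ p∣x) p∤x
    ... | inj₂ p∣y = ∣ᵤ⇒∣ p∣y

    p∤small : ∀ {k} → k ℕ.< p → .{{ℕ.NonZero k}} → ¬ (+ p ∣ + k)
    p∤small k<p p∣k = ℕ.>⇒∤ k<p (∣⇒∣ᵤ p∣k)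

    p∤! : ∀ {n} → n ℕ.< p → ¬ (+ p ∣ + (n !))
    p∤! {zero}  0<p = p∤small (ℕ.≤∧≢⇒< (ℕ.>-nonZero⁻¹ p) λ { refl → 1-not-prime p-prime })
      where
      1-not-prime : ¬ Prime 1
      1-not-prime ()
    p∤! {suc n} n<p = subst (λ z → ¬ (+ p ∣ z)) (sym (+suc! n)) (p∤-* (p∤small n<p) (p∤! (ℕ.<⇒≤ n<p)))

    cancel-p : ∀ c {x y} → ¬ (+ p ∣ c) → c * x Mod-p.≈ c * y → x Mod-p.≈ y
    cancel-p c {x} {y} p∤c cx≈cy =
      Mod-p.∣⇒≈ (p∣*⇒p∣ʳ p∤c (subst (+ p ∣_) (lem c x y) (Mod-p.≈⇒∣ cx≈cy)))
      where
      lem : ∀ c x y → c * x - c * y ≡ c * (x - y)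
      lem = solve-∀

    -- Euclid's lemma is applied twice: first to obtain x - y = l p, then, after one `p` is
    -- cancelled from c l p = k p p, to obtain p ∣ l.
    cancel-p² : ∀ c {x y} → ¬ (+ p ∣ c) → c * x Mod-p².≈ c * y → x Mod-p².≈ y
    cancel-p² c {x} {y} p∤c cx≈cy with Mod-p².≈⇒∣ cx≈cy
    ... | divides k eq
      with p∣*⇒p∣ʳ {c} {x - y} p∤c (divides (k * + p) (trans (lem₁ c x y) (trans eq (lem₂ k (+ p)))))
      where
      lem₁ : ∀ c x y → c * (x - y) ≡ c * x - c * y
      lem₁ = solve-∀
      lem₂ : ∀ k p → k * (p * p) ≡ k * p * p
      lem₂ = solve-∀
    ... | divides l eq′
      with p∣*⇒p∣ʳ {c} {l} p∤c (divides k (*-cancelˡ-≡ (+ p) _ _ (begin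
        + p * (c * l)       ≡⟨ lem₁ (+ p) c l ⟩
        c * (l * + p)       ≡⟨ cong (c *_) eq′ ⟨
        c * (x - y)         ≡⟨ lem₂ c x y ⟩
        c * x - c * y       ≡⟨ eq ⟩
        k * (+ p * + p)     ≡⟨ lem₃ k (+ p) ⟩
        + p * (k * + p)     ∎)))
      where
      open ≡-Reasoning
      lem₁ : ∀ p c l → p * (c * l) ≡ c * (l * p)
      lem₁ = solve-∀
      lem₂ : ∀ c x y → c * (x - y) ≡ c * x - c * y
      lem₂ = solve-∀
      lem₃ : ∀ k p → k * (p * p) ≡ p * (k * p)
      lem₃ = solve-∀
    ... | divides m eq″ = Mod-p².∣⇒≈ (divides m (trans eq′ (trans (cong (_* + p) eq″) (*-assoc m (+ p) (+ p)))))

    ≈p²⇒≈p : ∀ {x y} → x Mod-p².≈ y → x Mod-p.≈ y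
    ≈p²⇒≈p {y = y} (Mod-p².mod k eq) = Mod-p.mod (k * + p) (trans eq (cong (λ z → y + z) (sym (*-assoc k (+ p) (+ p)))))

  -- Signs, and expansions to first order in t

  sgn-+ : ∀ m n → sgn (m ℕ.+ n) ≡ sgn m * sgn n
  sgn-+ zero    n = lem (sgn n)
    where
    lem : ∀ x → x ≡ + 1 * x
    lem = solve-∀
  sgn-+ (suc m) n = trans (cong -_ (sgn-+ m n)) (lem (sgn m) (sgn n))
    where
    lem : ∀ x y → - (x * y) ≡ - x * y
    lem = solve-∀

  sgn² : ∀ n → sgn n * sgn n ≡ + 1
  sgn² zero    = refl
  sgn² (suc n) = trans (lem (sgn n)) (sgn² n)
    where
    lem : ∀ x → - x * - x ≡ x * x
    lem = solve-∀

  -- The coefficients of t in the expansions of (1 + t)_n, of B t y n and of ∏_{i<n} (t + 2i + 1).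
  poch-one-slope : ℕ → ℤ
  poch-one-slope zero    = + 0
  poch-one-slope (suc n) = poch-one-slope n * + suc n + + (n !)

  B-slope : ℤ → ℕ → ℤ
  B-slope y zero    = + 0
  B-slope y (suc n) = B-slope y n * (y * + suc n) - + (n !)

  oddProd-slope : ℕ → ℤ
  oddProd-slope zero    = + 0
  oddProd-slope (suc n) = oddProd-slope n * (+ 2 * + n + + 1) + oddProd (+ 0) n

  module FirstOrder (P : ℤ) where
    open Congruence (P * P)
    open ≈-Reasoning

    -- Terms of second order in `P * t` are multiples of `P * P`; the witness passed to `mod` is
    -- what they leave after that division.
    poch-one-linear : ∀ t n → pochℤ (P * t + + 1) n ≈ + (n !) + P * t * poch-one-slope n
    poch-one-linear t zero = ≡⇒≈ (lem (P * t))
      where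
      lem : ∀ x → + 1 ≡ + 1 + x * + 0
      lem = solve-∀
    poch-one-linear t (suc n) = begin
      pochℤ (P * t + + 1) n * (P * t + + 1 + + n)
        ≈⟨ *-congʳ _ (poch-one-linear t n) ⟩
      (+ (n !) + P * t * poch-one-slope n) * (P * t + + 1 + + n)
        ≈⟨ mod (t * t * poch-one-slope n) (lem (+ (n !)) P t (poch-one-slope n) (+ n)) ⟩
      + suc n * + (n !) + P * t * poch-one-slope (suc n)
        ≡⟨ cong (λ z → z + P * t * poch-one-slope (suc n)) (+suc! n) ⟨
      + (suc n !) + P * t * poch-one-slope (suc n) ∎
      where
      lem : ∀ f P t s n → (f + P * t * s) * (P * t + + 1 + n) ≡
            (+ 1 + n) * f + P * t * (s * (+ 1 + n) + f) + t * t * s * (P * P)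
      lem = solve-∀

    -- The factor of index 0 is already `- (P * t)`, so the other factors matter only through their
    -- values at t = 0.
    poch-zero-linear : ∀ t n → pochℤ (- (P * t)) (suc n) ≈ - (P * t) * + (n !)
    poch-zero-linear t zero = ≡⇒≈ (lem (P * t))
      where
      lem : ∀ x → + 1 * (- x + + 0) ≡ - x * + 1
      lem = solve-∀
    poch-zero-linear t (suc n) = begin
      pochℤ (- (P * t)) (suc n) * (- (P * t) + + suc n) ≈⟨ *-congʳ _ (poch-zero-linear t n) ⟩
      - (P * t) * + (n !) * (- (P * t) + + suc n)       ≈⟨ mod (t * t * + (n !)) (lem P t (+ (n !)) (+ suc n)) ⟩
      - (P * t) * (+ suc n * + (n !))                   ≡⟨ cong (- (P * t) *_) (+suc! n) ⟨
      - (P * t) * + (suc n !)                           ∎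
      where
      lem : ∀ P t f k → - (P * t) * f * (- (P * t) + k) ≡ - (P * t) * (k * f) + t * t * f * (P * P)
      lem = solve-∀

    B-linear : ∀ t y n → B (P * t) y n ≈ + (n !) * y ^ n + P * t * B-slope y n
    B-linear t y zero = ≡⇒≈ (lem (P * t))
      where
      lem : ∀ x → + 1 ≡ + 1 + x * + 0
      lem = solve-∀
    B-linear t y (suc n) = begin
      B (P * t) y n * (y * + suc n) + pochℤ (- (P * t)) (suc n)
        ≈⟨ +-cong (*-congʳ _ (B-linear t y n)) (poch-zero-linear t n) ⟩
      (+ (n !) * y ^ n + P * t * B-slope y n) * (y * + suc n) + - (P * t) * + (n !)
        ≡⟨ lem (+ (n !)) (y ^ n) (P * t) (B-slope y n) y (+ suc n) ⟩
      + suc n * + (n !) * (y * y ^ n) + P * t * B-slope y (suc n)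
        ≡⟨ cong (λ z → z * (y * y ^ n) + P * t * B-slope y (suc n)) (+suc! n) ⟨
      + (suc n !) * y ^ suc n + P * t * B-slope y (suc n) ∎
      where
      lem : ∀ f z x s y k → (f * z + x * s) * (y * k) + - x * f ≡ k * f * (y * z) + x * (s * (y * k) - f)
      lem = solve-∀

    num-linear : ∀ t n → num (P * t) (suc n) ≈ - (P * t) * (+ (n !) * + (suc n !))
    num-linear t n = begin
      pochℤ (- (P * t)) (suc n) * pochℤ (P * t + + 1) (suc n)
        ≈⟨ *-cong (poch-zero-linear t n) (poch-one-linear t (suc n)) ⟩
      - (P * t) * + (n !) * (+ (suc n !) + P * t * poch-one-slope (suc n))
        ≈⟨ mod (- (t * t * + (n !) * poch-one-slope (suc n))) (lem P t (+ (n !)) (+ (suc n !)) (poch-one-slope (suc n))) ⟩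
      - (P * t) * (+ (n !) * + (suc n !)) ∎
      where
      lem : ∀ P t f g s → - (P * t) * f * (g + P * t * s) ≡ - (P * t) * (f * g) + - (t * t * f * s) * (P * P)
      lem = solve-∀

    -- For k > 0 the factor (-P t)_k is divisible by `P * t`, so (P t + 1)_k may be replaced by k!,
    -- which cancels one k! of the denominator. What remains is the truncated binomial series at y =
    -- 2, hence the slope of `B`.
    V-linear : ∀ t n → V (P * t) n ≈ + (n !) * (+ (n !) * (+ 2) ^ n + P * t * B-slope (+ 2) n)
    V-linear t zero = ≡⇒≈ (lem (P * t))
      where
      lem : ∀ x → + 1 ≡ + 1 * (+ 1 + x * + 0)
      lem = solve-∀
    V-linear t (suc n) = begin
      V (P * t) n * (+ 2 * (k * k)) + num (P * t) (suc n)
        ≈⟨ +-cong (*-congʳ _ (V-linear t n)) (num-linear t n) ⟩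
      f * (f * (+ 2) ^ n + P * t * s) * (+ 2 * (k * k)) + - (P * t) * (f * + (suc n !))
        ≡⟨ cong (λ z → f * (f * (+ 2) ^ n + P * t * s) * (+ 2 * (k * k)) + - (P * t) * (f * z)) (+suc! n) ⟩
      f * (f * (+ 2) ^ n + P * t * s) * (+ 2 * (k * k)) + - (P * t) * (f * (k * f))
        ≡⟨ lem f ((+ 2) ^ n) (P * t) s k ⟩
      k * f * (k * f * (+ 2 * (+ 2) ^ n) + P * t * (s * (+ 2 * k) - f))
        ≡⟨ cong (λ z → z * (z * (+ 2) ^ suc n + P * t * B-slope (+ 2) (suc n))) (+suc! n) ⟨
      + (suc n !) * (+ (suc n !) * (+ 2) ^ suc n + P * t * B-slope (+ 2) (suc n)) ∎
      where
      k = + suc n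
      f = + (n !)
      s = B-slope (+ 2) n
      lem : ∀ f e x s k → f * (f * e + x * s) * (+ 2 * (k * k)) + - x * (f * (k * f)) ≡
            k * f * (k * f * (+ 2 * e) + x * (s * (+ 2 * k) - f))
      lem = solve-∀

    oddProd-linear : ∀ t n → oddProd (P * t) n ≈ oddProd (+ 0) n + P * t * oddProd-slope n
    oddProd-linear t zero = ≡⇒≈ (lem (P * t))
      where
      lem : ∀ x → + 1 ≡ + 1 + x * + 0
      lem = solve-∀
    oddProd-linear t (suc n) = begin
      oddProd (P * t) n * (P * t + j)      ≈⟨ *-congʳ (P * t + j) (oddProd-linear t n) ⟩
      (k + P * t * s) * (P * t + j)        ≈⟨ mod (t * t * s) (lem k P t s j) ⟩
      k * (+ 0 + j) + P * t * (s * j + k)  ∎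
      where
      j = + 2 * + n + + 1
      k = oddProd (+ 0) n
      s = oddProd-slope n
      lem : ∀ k P t s j → (k + P * t * s) * (P * t + j) ≡ k * (+ 0 + j) + P * t * (s * j + k) + t * t * s * (P * P)
      lem = solve-∀

  -- Finite differences

  -- Wilson's theorem: Δ^{p−1} x^{p−1} = (p−1)!, while mod p the function x^{p−1} is 0 at 0 and 1 at 1, …, p−1.
  Δ^ : ℕ → (ℕ → ℤ) → ℕ → ℤ
  Δ^ zero    f x = f x
  Δ^ (suc n) f x = Δ^ n f (suc x) - Δ^ n f x

  -- The Leibniz rule stops after two terms because the second difference of x is zero.
  Δ^-leibniz : ∀ n f x → Δ^ (suc n) (λ x → + x * f x) x ≡ + x * Δ^ (suc n) f x + + suc n * Δ^ n f (suc x)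
  Δ^-leibniz zero    f x = lem (+ x) (f x) (f (suc x))
    where
    lem : ∀ x a b → (+ 1 + x) * b - x * a ≡ x * (b - a) + + 1 * b
    lem = solve-∀
  Δ^-leibniz (suc n) f x = trans
    (cong₂ _-_ (Δ^-leibniz n f (suc x)) (Δ^-leibniz n f x))
    (lem (+ x) (+ n) (Δ^ n f x) (Δ^ n f (suc x)) (Δ^ n f (suc (suc x))))
    where
    lem : ∀ x n a b c →
      (+ 1 + x) * (c - b) + (+ 1 + n) * c - (x * (b - a) + (+ 1 + n) * b) ≡
      x * ((c - b) - (b - a)) + (+ 1 + (+ 1 + n)) * (c - b)
    lem = solve-∀

  Δ^-power : ∀ n x → Δ^ n (λ x → (+ x) ^ n) x ≡ + (n !)
  Δ^-power zero    x = refl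
  Δ^-power (suc n) x = begin
    Δ^ (suc n) (λ x → + x * (+ x) ^ n) x                                       ≡⟨ Δ^-leibniz n (λ x → (+ x) ^ n) x ⟩
    + x * (Δ^ n (λ x → (+ x) ^ n) (suc x) - Δ^ n (λ x → (+ x) ^ n) x) + + suc n * Δ^ n (λ x → (+ x) ^ n) (suc x)
      ≡⟨ cong₂ (λ u v → + x * (u - v) + + suc n * u) (Δ^-power n (suc x)) (Δ^-power n x) ⟩
    + x * (+ (n !) - + (n !)) + + suc n * + (n !)                            ≡⟨ lem (+ x) (+ (n !)) (+ suc n * + (n !)) ⟩
    + suc n * + (n !)                                                        ≡⟨ +suc! n ⟨
    + (suc n !) ∎
    where
    open ≡-Reasoning
    lem : ∀ x f g → x * (f - f) + g ≡ g
    lem = solve-∀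

  module FiniteDifferences (q : ℤ) where
    open Congruence q
    open ≈-Reasoning

    -‿cong : ∀ {x y u v} → x ≈ y → u ≈ v → x - u ≈ y - v
    -‿cong x≈y u≈v = +-cong x≈y (neg-cong u≈v)

    -- The difference involves `f` only at the arguments x + 1, ..., x + n + 2, which explains the
    -- bound.
    Δ^-const : ∀ N f → (∀ k → suc k ℕ.≤ N → f (suc k) ≈ + 1) → ∀ n x → suc (suc (x ℕ.+ n)) ℕ.≤ N → Δ^ (suc n) f (suc x) ≈ + 0
    Δ^-const N f f≈1 zero x x≤N = -‿cong
      (f≈1 (suc x) (subst (ℕ._≤ N) (cong (λ z → suc (suc z)) (ℕ.+-identityʳ x)) x≤N))
      (f≈1 x (ℕ.≤-trans (ℕ.s≤s (ℕ.≤-trans (ℕ.m≤m+n x 0) (ℕ.n≤1+n _))) x≤N))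
    Δ^-const N f f≈1 (suc n) x x≤N = -‿cong
      (Δ^-const N f f≈1 n (suc x) x≤N′)
      (Δ^-const N f f≈1 n x (ℕ.≤-trans (ℕ.n≤1+n _) x≤N′))
      where
      x≤N′ : suc (suc (suc (x ℕ.+ n))) ℕ.≤ N
      x≤N′ = subst (ℕ._≤ N) (cong (λ z → suc (suc z)) (ℕ.+-suc x n)) x≤N

    -- The lower difference at 1 does not see the exceptional value `f 0` and vanishes by
    -- `Δ^-const`, so each further difference only changes the sign.
    Δ^-spike : ∀ N f → f 0 ≈ + 0 → (∀ k → suc k ℕ.≤ N → f (suc k) ≈ + 1) → ∀ n → suc n ℕ.≤ N → Δ^ (suc n) f 0 ≈ sgn n
    Δ^-spike N f f0≈0 f≈1 zero    1≤N = -‿cong (f≈1 0 1≤N) f0≈0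
    Δ^-spike N f f0≈0 f≈1 (suc n) n≤N = begin
      Δ^ (suc n) f 1 - Δ^ (suc n) f 0 ≈⟨ -‿cong (Δ^-const N f f≈1 n 0 n≤N) (Δ^-spike N f f0≈0 f≈1 n (ℕ.<⇒≤ n≤N)) ⟩
      + 0 - sgn n                     ≡⟨ lem (sgn n) ⟩
      - sgn n                         ∎
      where
      lem : ∀ x → + 0 - x ≡ - x
      lem = solve-∀

  -- Rational numbers as unreduced fractions

  -- x = N / d, without requiring d ≠ 0 or lowest terms.
  record Represents (x : ℚ) (N d : ℤ) : Set where
    constructor represents
    field
      cross : ↥ x * d ≡ N * ↧ x

  /-represents : ∀ N d .{{_ : ℕ.NonZero d}} → Represents (N ℚ./ d) N (+ d)
  /-represents N (suc d) with toℚᵘ-fromℚᵘ (mkℚᵘ N d)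
  ... | *≡* eq = represents (trans (cong (_* + suc d) (sym (↥ᵘ-toℚᵘ x))) (trans eq (cong (N *_) (↧ᵘ-toℚᵘ x))))
    where
    x = N ℚ./ suc d

  +-represents : ∀ {x y N M d c} → Represents x N d → Represents y M c → Represents (x ℚ.+ y) (N * c + M * d) (d * c)
  +-represents {x} {y} {N} {M} {d} {c} (represents ex) (represents ey) = represents (go x y ex ey (toℚᵘ-homo-+ x y))
    where
    lem : ∀ u v a b A B N M d c → u * (a * b) ≡ (A * b + B * a) * v → A * d ≡ N * a → B * c ≡ M * b →
          a * b * (u * (d * c)) ≡ a * b * ((N * c + M * d) * v)
    lem u v a b A B N M d c eq eqA eqB = begin
      a * b * (u * (d * c))                       ≡⟨ lem₁ a b u d c ⟩
      u * (a * b) * (d * c)                       ≡⟨ cong (_* (d * c)) eq ⟩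
      (A * b + B * a) * v * (d * c)               ≡⟨ lem₂ A B a b d c v ⟩
      (A * d * (b * c) + B * c * (a * d)) * v     ≡⟨ cong₂ (λ x y → (x * (b * c) + y * (a * d)) * v) eqA eqB ⟩
      (N * a * (b * c) + M * b * (a * d)) * v     ≡⟨ lem₃ N M a b d c v ⟩
      a * b * ((N * c + M * d) * v)               ∎
      where
      open ≡-Reasoning
      lem₁ : ∀ a b u d c → a * b * (u * (d * c)) ≡ u * (a * b) * (d * c)
      lem₁ = solve-∀
      lem₂ : ∀ A B a b d c v → (A * b + B * a) * v * (d * c) ≡ (A * d * (b * c) + B * c * (a * d)) * v
      lem₂ = solve-∀
      lem₃ : ∀ N M a b d c v → (N * a * (b * c) + M * b * (a * d)) * v ≡ a * b * ((N * c + M * d) * v)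
      lem₃ = solve-∀
    go : ∀ x y → ↥ x * d ≡ N * ↧ x → ↥ y * c ≡ M * ↧ y → toℚᵘ (x ℚ.+ y) ℚᵘ.≃ toℚᵘ x ℚᵘ.+ toℚᵘ y →
         ↥ (x ℚ.+ y) * (d * c) ≡ (N * c + M * d) * ↧ (x ℚ.+ y)
    -- Matching on `mkℚ` lets `toℚᵘ` compute, so that `eq` speaks of numerators and denominators.
    go x@(mkℚ _ _ _) y@(mkℚ _ _ _) ex ey (*≡* eq) = *-cancelˡ-≡ (↧ x * ↧ y) _ _
      (lem (↥ (x ℚ.+ y)) (↧ (x ℚ.+ y)) (↧ x) (↧ y) (↥ x) (↥ y) N M d c
        (subst (λ z → z * (↧ x * ↧ y) ≡ (↥ x * ↧ y + ↥ y * ↧ x) * ↧ (x ℚ.+ y)) (↥ᵘ-toℚᵘ (x ℚ.+ y))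
          (trans eq (cong ((↥ x * ↧ y + ↥ y * ↧ x) *_) (↧ᵘ-toℚᵘ (x ℚ.+ y))))) ex ey)

  neg-represents : ∀ {x N d} → Represents x N d → Represents (ℚ.- x) (- N) d
  neg-represents {x} {N} {d} (represents eq) = represents (begin
    ↥ (ℚ.- x) * d    ≡⟨ cong (_* d) (↥-neg x) ⟩
    - (↥ x) * d      ≡⟨ lem (↥ x) d ⟩
    - (↥ x * d)      ≡⟨ cong -_ eq ⟩
    - (N * ↧ x)      ≡⟨ lem N (↧ x) ⟨
    - N * ↧ x        ≡⟨ cong (- N *_) (↧-neg x) ⟨
    - N * ↧ (ℚ.- x)  ∎)
    where
    open ≡-Reasoning
    lem : ∀ a b → - a * b ≡ - (a * b)
    lem = solve-∀

  represents-cancel : ∀ {x N d} k .{{_ : NonZero k}} → Represents x (k * N) (k * d) → Represents x N d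
  represents-cancel {x} {N} {d} k (represents eq) = represents (*-cancelˡ-≡ k _ _ (trans (lem k (↥ x) d) (trans eq (*-assoc k N (↧ x)))))
    where
    lem : ∀ k a d → k * (a * d) ≡ a * (k * d)
    lem = solve-∀

  -- The ratio of consecutive denominators is the factor by which `V` is multiplied in its
  -- recursion.
  den-suc : ∀ n → + den (suc n) ≡ + den n * (+ 2 * (+ suc n * + suc n))
  den-suc n = begin
    + den (suc n)                             ≡⟨ cong +_ (lem (pochℕ 1 n) (suc n) (2 ℕ.^ n) (n !)) ⟩
    + (den n ℕ.* (2 ℕ.* (suc n ℕ.* suc n)))   ≡⟨ pos-* (den n) (2 ℕ.* (suc n ℕ.* suc n)) ⟩
    + den n * + (2 ℕ.* (suc n ℕ.* suc n))     ≡⟨ cong (+ den n *_) (pos-* 2 (suc n ℕ.* suc n)) ⟩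
    + den n * (+ 2 * + (suc n ℕ.* suc n))     ≡⟨ cong (λ z → + den n * (+ 2 * z)) (pos-* (suc n) (suc n)) ⟩
    + den n * (+ 2 * (+ suc n * + suc n))     ∎
    where
    open ≡-Reasoning
    lem : ∀ x k y z → x ℕ.* k ℕ.* (2 ℕ.* y) ℕ.* (k ℕ.* z) ≡ x ℕ.* y ℕ.* z ℕ.* (2 ℕ.* (k ℕ.* k))
    lem = ℕ.solve-∀

  sum-represents : ∀ a n → Represents (sumTo (suc n) (term a)) (V a n) (+ den n)
  sum-represents a zero    = +-represents (represents {ℚ.0ℚ} {+ 0} {+ 1} refl) (/-represents (num a 0) 1)
  -- Addition gives the denominator `den n * den (suc n)`; by `den-suc` the numerator has the factor
  -- `den n` as well, and it is cancelled.
  sum-represents a (suc n) = represents-cancel (+ den n) {{den≢0 n}} (regroup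
    (+-represents (sum-represents a n) (/-represents (num a (suc n)) (den (suc n)) {{den≢0 (suc n)}})))
    where
    lem : ∀ V d r x → V * (d * r) + x * d ≡ d * (V * r + x)
    lem = solve-∀
    regroup : Represents (sumTo (suc (suc n)) (term a)) (V a n * + den (suc n) + num a (suc n) * + den n) (+ den n * + den (suc n)) →
              Represents (sumTo (suc (suc n)) (term a)) (+ den n * V a (suc n)) (+ den n * + den (suc n))
    regroup = subst (λ z → Represents (sumTo (suc (suc n)) (term a)) z (+ den n * + den (suc n)))
      (trans (cong (λ z → V a n * z + num a (suc n) * + den n) (den-suc n)) (lem (V a n) (+ den n) _ (num a (suc n))))

  den-product : ∀ n → + den n ≡ + (n !) * (+ 2) ^ n * + (n !)
  den-product zero    = refl
  den-product (suc n) = begin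
    + den (suc n)                                                        ≡⟨ den-suc n ⟩
    + den n * (+ 2 * (+ suc n * + suc n))                                ≡⟨ cong (_* (+ 2 * (+ suc n * + suc n))) (den-product n) ⟩
    + (n !) * (+ 2) ^ n * + (n !) * (+ 2 * (+ suc n * + suc n))          ≡⟨ lem (+ (n !)) ((+ 2) ^ n) (+ suc n) ⟩
    + suc n * + (n !) * (+ 2 * (+ 2) ^ n) * (+ suc n * + (n !))          ≡⟨ cong (λ z → z * (+ 2) ^ suc n * z) (+suc! n) ⟨
    + (suc n !) * (+ 2) ^ suc n * + (suc n !)                            ∎
    where
    open ≡-Reasoning
    lem : ∀ f e k → f * e * f * (+ 2 * (k * k)) ≡ k * f * (+ 2 * e) * (k * f)
    lem = solve-∀

  -- Fractions in ℚ are in lowest terms, so the condition on the denominator follows from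
  -- divisibility of the numerator.
  ¬∣denominator : ∀ p (x : ℚ) → ¬ p ≡ 1 → + p ∣ ↥ x → ¬ p ℕ.∣ ↧ₙ x
  ¬∣denominator p (mkℚ _ _ c) p≢1 p∣num p∣den = p≢1 (Coprime.recompute c (∣⇒∣ᵤ p∣num , p∣den))

  -- Morita's Gamma function at natural numbers

  module Gamma (p : ℕ) where

    prodCoprime-unit : ∀ m → ¬ p ℕ.∣ m → prodCoprime p (suc m) ≡ prodCoprime p m * + m
    prodCoprime-unit m p∤m with m | p ℕ.∣? m
    ... | zero  | _       = contradiction (p ℕ.∣0) p∤m
    ... | suc j | yes p∣m = contradiction p∣m p∤m
    ... | suc j | no _    = refl

    prodCoprime-multiple : ∀ m → p ℕ.∣ m → prodCoprime p (suc m) ≡ prodCoprime p m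
    prodCoprime-multiple m p∣m with m | p ℕ.∣? m
    ... | zero  | _      = refl
    ... | suc j | yes _  = refl
    ... | suc j | no p∤m = contradiction p∣m p∤m

    Gp-unit : ∀ m → ¬ p ℕ.∣ m → Gp p (suc m) ≡ - (+ m) * Gp p m
    Gp-unit m p∤m = trans (cong (- sgn m *_) (prodCoprime-unit m p∤m)) (lem (sgn m) (prodCoprime p m) (+ m))
      where
      lem : ∀ s x m → - s * (x * m) ≡ - m * (s * x)
      lem = solve-∀

    Gp-multiple : ∀ m → p ℕ.∣ m → Gp p (suc m) ≡ - Gp p m
    Gp-multiple m p∣m = trans (cong (- sgn m *_) (prodCoprime-multiple m p∣m)) (lem (sgn m) (prodCoprime p m))
      where
      lem : ∀ s x → - s * x ≡ - (s * x)
      lem = solve-∀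

    -- Passing the multiple `p * u` only changes the sign; the next `j` arguments are prime to `p`
    -- and contribute the factors -(p u + i) for 1 ≤ i ≤ j.
    Gp-block : ∀ u j → j ℕ.< p →
      Gp p (suc (j ℕ.+ p ℕ.* u)) ≡ - sgn j * Gp p (p ℕ.* u) * pochℤ (+ p * + u + + 1) j
    Gp-block u zero    _   = trans (Gp-multiple (p ℕ.* u) (ℕ.m∣m*n u)) (lem (Gp p (p ℕ.* u)))
      where
      lem : ∀ x → - x ≡ - (+ 1) * x * + 1
      lem = solve-∀
    Gp-block u (suc j) j<p = begin
      Gp p (suc (suc j ℕ.+ p ℕ.* u))
        ≡⟨ Gp-unit (suc j ℕ.+ p ℕ.* u) (λ p∣ → ℕ.>⇒∤ j<p (ℕ.∣m+n∣m⇒∣n (subst (p ℕ.∣_) (ℕ.+-comm (suc j) (p ℕ.* u)) p∣) (ℕ.m∣m*n u))) ⟩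
      - (+ suc j + + (p ℕ.* u)) * Gp p (suc (j ℕ.+ p ℕ.* u))
        ≡⟨ cong₂ (λ x y → - (+ suc j + x) * y) (pos-* p u) (Gp-block u j (ℕ.<⇒≤ j<p)) ⟩
      - (+ suc j + + p * + u) * (- sgn j * g * pochℤ (+ p * + u + + 1) j)
        ≡⟨ lem (+ j) (+ p * + u) (- sgn j) g (pochℤ (+ p * + u + + 1) j) ⟩
      - - sgn j * g * (pochℤ (+ p * + u + + 1) j * (+ p * + u + + 1 + + j)) ∎
      where
      open ≡-Reasoning
      g = Gp p (p ℕ.* u)
      lem : ∀ j x s g y → - ((+ 1 + j) + x) * (s * g * y) ≡ - s * g * (y * (x + + 1 + j))
      lem = solve-∀

  -- Fermat's and Wilson's theorems for p = 2h + 1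

  module OddPrime (h : ℕ) (0<h : 0 ℕ.< h) (p-prime : Prime (suc (h ℕ.+ h))) where

    n p : ℕ
    n = h ℕ.+ h
    p = suc n

    open PrimeModulus p p-prime
    open Mod-p²
    open FirstOrder (+ p)
    open Gamma p

    w e : ℤ
    w = + (n !)
    e = (+ 2) ^ n

    sgn-n : sgn n ≡ + 1
    sgn-n = trans (sgn-+ h h) (sgn² h)

    p∤w : ¬ (+ p ∣ w)
    p∤w = p∤! ℕ.≤-refl

    B-at-p : ∀ k → + suc k * B (+ p) (+ suc k) n ≡ ((+ k) ^ p + + 1) * w
    B-at-p k = trans (B-above-diagonal k n) (cong (λ z → ((+ k) ^ p + z) * w) sgn-n)

    B-at-p-linear : ∀ y → B (+ p) y n ≈ w * y ^ n + + p * B-slope y n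
    B-at-p-linear y = subst (λ z → B z y n ≈ w * y ^ n + z * B-slope y n) (*-identityʳ (+ p)) (B-linear (+ 1) y n)

    module _ where
      open Mod-p using () renaming (_≈_ to _≈ₚ_)
      open Mod-p.≈-Reasoning

      -- Two evaluations of `y * B (+ p) y n` are compared: modulo `p` every summand but the first
      -- vanishes, leaving w y^p, while the binomial theorem gives (k^p + 1) w.
      fermat-step : ∀ k → (+ suc k) ^ p ≈ₚ (+ k) ^ p + + 1
      fermat-step k = cancel-p w p∤w (begin
        w * (y * y ^ n)                           ≈⟨ Mod-p.mod (- (y * B-slope y n)) (lem₁ w y (y ^ n) (+ p) (B-slope y n)) ⟩
        y * (w * y ^ n + + p * B-slope y n)       ≈⟨ Mod-p.*-congˡ y (≈p²⇒≈p (B-at-p-linear y)) ⟨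
        y * B (+ p) y n                           ≡⟨ B-at-p k ⟩
        ((+ k) ^ p + + 1) * w                     ≡⟨ *-comm _ w ⟩
        w * ((+ k) ^ p + + 1)                     ∎)
        where
        y = + suc k
        lem₁ : ∀ w y z p s → w * (y * z) ≡ y * (w * z + p * s) + - (y * s) * p
        lem₁ = solve-∀

      fermat : ∀ k → (+ k) ^ p ≈ₚ + k
      fermat zero    = Mod-p.≡⇒≈ (*-zeroˡ ((+ 0) ^ n))
      fermat (suc k) = begin
        (+ suc k) ^ p     ≈⟨ fermat-step k ⟩
        (+ k) ^ p + + 1   ≈⟨ Mod-p.+-congʳ (+ 1) (fermat k) ⟩
        + k + + 1         ≡⟨ lem (+ k) ⟩
        + suc k           ∎
        where
        lem : ∀ k → k + + 1 ≡ + 1 + k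
        lem = solve-∀

      fermat-unit : ∀ k → suc k ℕ.≤ n → (+ suc k) ^ n ≈ₚ + 1
      fermat-unit k k<n = cancel-p (+ suc k) (p∤small (ℕ.s≤s k<n)) (begin
        (+ suc k) ^ p     ≈⟨ fermat (suc k) ⟩
        + suc k           ≡⟨ *-identityʳ (+ suc k) ⟨
        + suc k * + 1     ∎)

      wilson : w ≈ₚ - (+ 1)
      -- `Δ^-spike` needs an order of the form `suc m`, but `h ℕ.+ h` does not reduce to a
      -- successor; the equation is therefore passed along.
      wilson = wilson′ n refl
        where
        open FiniteDifferences (+ p)
        wilson′ : ∀ m → n ≡ m → + (n !) ≈ₚ - (+ 1)
        wilson′ zero    n≡0 = contradiction (subst (λ z → Prime (suc z)) n≡0 p-prime) λ ()
        wilson′ (suc m) n≡1+m = begin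
          + (n !)                          ≡⟨ Δ^-power n 0 ⟨
          Δ^ n (λ x → (+ x) ^ n) 0         ≡⟨ cong (λ z → Δ^ z (λ x → (+ x) ^ n) 0) n≡1+m ⟩
          Δ^ (suc m) (λ x → (+ x) ^ n) 0   ≈⟨ Δ^-spike n _ (Mod-p.≡⇒≈ (cong ((+ 0) ^_) n≡1+m)) fermat-unit m (ℕ.≤-reflexive (sym n≡1+m)) ⟩
          sgn m                            ≡⟨ lem (sgn m) ⟩
          - (- sgn m)                      ≡⟨ cong (λ z → - sgn z) n≡1+m ⟨
          - sgn n                          ≡⟨ cong -_ sgn-n ⟩
          - (+ 1)                          ∎
          where
          lem : ∀ x → x ≡ - - x
          lem = solve-∀

    -- The Gamma function modulo p²

    open ≈-Reasoning

    one-plus-multiple^ : ∀ z m → (+ 1 + z * + p) ^ m ≈ + 1 + + m * (z * + p)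
    one-plus-multiple^ z zero    = ≈-refl
    one-plus-multiple^ z (suc m) = begin
      (+ 1 + z * + p) * (+ 1 + z * + p) ^ m     ≈⟨ *-congˡ (+ 1 + z * + p) (one-plus-multiple^ z m) ⟩
      (+ 1 + z * + p) * (+ 1 + + m * (z * + p)) ≈⟨ mod (+ m * z * z) (lem z (+ p) (+ m)) ⟩
      + 1 + + suc m * (z * + p)                 ∎
      where
      lem : ∀ z p m → (+ 1 + z * p) * (+ 1 + m * (z * p)) ≡ + 1 + (+ 1 + m) * (z * p) + m * z * z * (p * p)
      lem = solve-∀

    v : ℤ
    v = - w

    -- By Wilson v = 1 + z p, and the power p turns the linear term z p into a multiple of p².
    v^p : v ^ p ≈ + 1
    v^p with wilson
    ... | Mod-p.mod k eq = begin
      v ^ p                             ≡⟨ cong (_^ p) (trans (cong -_ eq) (lem₁ k (+ p))) ⟩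
      (+ 1 + - k * + p) ^ p             ≈⟨ one-plus-multiple^ (- k) p ⟩
      + 1 + + p * (- k * + p)           ≈⟨ mod (- k) (lem₂ (+ p) (- k)) ⟩
      + 1                               ∎
      where
      lem₁ : ∀ k p → - (- (+ 1) + k * p) ≡ + 1 + - k * p
      lem₁ = solve-∀
      lem₂ : ∀ p k → + 1 + p * (k * p) ≡ + 1 + k * (p * p)
      lem₂ = solve-∀

    -- The case t = −1 is the reflected product (−1)^{p−1} (p−1)!, which forces the linear coefficient in t to vanish.
    block-product : ∀ t → pochℤ (+ p * t + + 1) n ≈ w
    block-product t = begin
      pochℤ (+ p * t + + 1) n    ≈⟨ poch-one-linear t n ⟩
      w + + p * t * s            ≡⟨ lem₁ w (+ p) t s ⟩
      w + t * (+ p * s)          ≈⟨ +-congˡ w (*-congˡ t ps≈0) ⟩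
      w + t * + 0                ≡⟨ lem₂ w t ⟩
      w                          ∎
      where
      s = poch-one-slope n
      lem₁ : ∀ w p t s → w + p * t * s ≡ w + t * (p * s)
      lem₁ = solve-∀
      lem₂ : ∀ w t → w + t * + 0 ≡ w
      lem₂ = solve-∀
      lem₃ : ∀ w p s → p * s ≡ w - (w + p * - (+ 1) * s)
      lem₃ = solve-∀
      lem₄ : ∀ n → (+ 1 + n) * - (+ 1) + + 1 ≡ - (+ 0 + n)
      lem₄ = solve-∀
      lem₅ : ∀ w → w - w ≡ + 0
      lem₅ = solve-∀
      reflected : pochℤ (+ p * - (+ 1) + + 1) n ≡ w
      reflected = trans (cong (λ z → pochℤ z n) (lem₄ (+ n)))
        (trans (poch-neg n) (trans (cong (_* w) sgn-n) (*-identityˡ w)))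
      ps≈0 : + p * s ≈ + 0
      ps≈0 = begin
        + p * s                                 ≡⟨ lem₃ w (+ p) s ⟩
        w - (w + + p * - (+ 1) * s)             ≈⟨ +-congˡ w (neg-cong (poch-one-linear (- (+ 1)) n)) ⟨
        w - pochℤ (+ p * - (+ 1) + + 1) n       ≡⟨ cong (λ z → w - z) reflected ⟩
        w - w                                   ≡⟨ lem₅ w ⟩
        + 0                                     ∎

    -- By `block-product` every block of `p` arguments contributes the same factor `- w`, whatever
    -- its position.
    Gp-multiples : ∀ u → Gp p (p ℕ.* u) ≈ v ^ u
    Gp-multiples zero    = ≡⇒≈ (cong (Gp p) (ℕ.*-zeroʳ p))
    Gp-multiples (suc u) = begin
      Gp p (p ℕ.* suc u)                                           ≡⟨ cong (Gp p) (ℕ.*-suc p u) ⟩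
      Gp p (suc (n ℕ.+ p ℕ.* u))                                   ≡⟨ Gp-block u n ℕ.≤-refl ⟩
      - sgn n * Gp p (p ℕ.* u) * pochℤ (+ p * + u + + 1) n         ≈⟨ *-cong (*-congˡ (- sgn n) (Gp-multiples u)) (block-product (+ u)) ⟩
      - sgn n * v ^ u * w                                          ≡⟨ cong (λ z → - z * v ^ u * w) sgn-n ⟩
      - (+ 1) * v ^ u * w                                          ≡⟨ lem (v ^ u) w ⟩
      - w * v ^ u                                                  ∎
      where
      lem : ∀ x w → - (+ 1) * x * w ≡ - w * x
      lem = solve-∀

    -- At 0 this is `v^p`; the functional equation takes the same case, with congruent factors, at
    -- `m` and at m + p², and carries the congruence upwards.
    Gp-periodic : ∀ m → Gp p (m ℕ.+ p ℕ.* p) ≈ Gp p m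
    Gp-periodic zero    = ≈-trans (Gp-multiples p) v^p
    Gp-periodic (suc m) = step (p ℕ.∣? m)
      where
      lem : ∀ m q → m + q ≡ m + + 1 * q
      lem = solve-∀
      shift : ∀ m → + (m ℕ.+ p ℕ.* p) ≈ + m
      shift m = mod (+ 1) (trans (cong (λ z → + m + z) (pos-* p p)) (lem (+ m) (+ p * + p)))
      step : Dec (p ℕ.∣ m) → Gp p (suc m ℕ.+ p ℕ.* p) ≈ Gp p (suc m)
      step (yes p∣m) = begin
        Gp p (suc (m ℕ.+ p ℕ.* p)) ≡⟨ Gp-multiple (m ℕ.+ p ℕ.* p) (ℕ.∣m∣n⇒∣m+n p∣m (ℕ.m∣m*n p)) ⟩
        - Gp p (m ℕ.+ p ℕ.* p)     ≈⟨ neg-cong (Gp-periodic m) ⟩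
        - Gp p m                   ≡⟨ Gp-multiple m p∣m ⟨
        Gp p (suc m)               ∎
      step (no p∤m) = begin
        Gp p (suc (m ℕ.+ p ℕ.* p))
          ≡⟨ Gp-unit (m ℕ.+ p ℕ.* p) (λ p∣ → p∤m (ℕ.∣m+n∣m⇒∣n (subst (p ℕ.∣_) (ℕ.+-comm m (p ℕ.* p)) p∣) (ℕ.m∣m*n p))) ⟩
        - (+ m + + (p ℕ.* p)) * Gp p (m ℕ.+ p ℕ.* p)
          ≈⟨ *-cong (neg-cong (shift m)) (Gp-periodic m) ⟩
        - (+ m) * Gp p m
          ≡⟨ Gp-unit m p∤m ⟨
        Gp p (suc m) ∎

    Gp-periodic* : ∀ m k → Gp p (m ℕ.+ k ℕ.* (p ℕ.* p)) ≈ Gp p m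
    Gp-periodic* m zero    = ≡⇒≈ (cong (Gp p) (ℕ.+-identityʳ m))
    Gp-periodic* m (suc k) = begin
      Gp p (m ℕ.+ (p ℕ.* p ℕ.+ k ℕ.* (p ℕ.* p))) ≡⟨ cong (λ z → Gp p (m ℕ.+ z)) (ℕ.+-comm (p ℕ.* p) (k ℕ.* (p ℕ.* p))) ⟩
      Gp p (m ℕ.+ (k ℕ.* (p ℕ.* p) ℕ.+ p ℕ.* p)) ≡⟨ cong (Gp p) (ℕ.+-assoc m (k ℕ.* (p ℕ.* p)) (p ℕ.* p)) ⟨
      Gp p (m ℕ.+ k ℕ.* (p ℕ.* p) ℕ.+ p ℕ.* p)   ≈⟨ Gp-periodic (m ℕ.+ k ℕ.* (p ℕ.* p)) ⟩
      Gp p (m ℕ.+ k ℕ.* (p ℕ.* p))               ≈⟨ Gp-periodic* m k ⟩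
      Gp p m                                     ∎

    -- The integer quotient may have either sign; a negative one exchanges the roles of the two
    -- arguments.
    Gp-cong : ∀ {m m′} → + m ≈ + m′ → Gp p m ≈ Gp p m′
    Gp-cong {m} {m′} (mod k eq) = cases k eq
      where
      unfold : ∀ m m′ k → + m ≡ + m′ + + k * (+ p * + p) → m ≡ m′ ℕ.+ k ℕ.* (p ℕ.* p)
      unfold m m′ k eq = +-injective (trans eq (cong (λ z → + m′ + z)
        (trans (cong (+ k *_) (sym (pos-* p p))) (sym (pos-* k (p ℕ.* p))))))
      shifted : ∀ m m′ k → + m ≡ + m′ + + k * (+ p * + p) → Gp p m ≈ Gp p m′
      shifted m m′ k eq = subst (λ z → Gp p z ≈ Gp p m′) (sym (unfold m m′ k eq)) (Gp-periodic* m′ k)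
      lem : ∀ x k q → x ≡ x + k * q + - k * q
      lem = solve-∀
      cases : ∀ k → + m ≡ + m′ + k * (+ p * + p) → Gp p m ≈ Gp p m′
      cases (+ k)      eq = shifted m m′ k eq
      cases (-[1+ k ]) eq = ≈-sym (shifted m′ m (suc k)
        (trans (lem (+ m′) -[1+ k ] (+ p * + p)) (cong (λ z → z + + suc k * (+ p * + p)) (sym eq))))

    -- Both sides at a = p t

    H s c K₀ : ℤ
    H = + h
    s = sgn h
    c = (+ 2) ^ h
    K₀ = oddProd (+ 0) h

    2≤n : 2 ℕ.≤ n
    2≤n = ℕ.+-mono-≤ 0<h 0<h

    e≡c*c : e ≡ c * c
    e≡c*c = ^-distribˡ-+-* (+ 2) h h

    e≈ₚ1 : e Mod-p.≈ + 1
    e≈ₚ1 = fermat-unit 1 2≤n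

    ≈ₚ1⇒[x-1]²≈0 : ∀ x → x Mod-p.≈ + 1 → (x - + 1) * (x - + 1) ≈ + 0
    ≈ₚ1⇒[x-1]²≈0 x (Mod-p.mod k eq) = mod (k * k) (trans (cong (λ z → (z - + 1) * (z - + 1)) eq) (lem k (+ p)))
      where
      lem : ∀ k p → (+ 1 + k * p - + 1) * (+ 1 + k * p - + 1) ≡ + 0 + k * k * (p * p)
      lem = solve-∀

    p∤e : ¬ (+ p ∣ e)
    p∤e p∣e = p∤small (ℕ.s≤s (ℕ.≤-trans (ℕ.n≤1+n 1) 2≤n)) (Mod-p.≈0⇒∣ (Mod-p.≈-trans (Mod-p.≈-sym e≈ₚ1) (Mod-p.∣⇒≈ (subst (+ p ∣_) (lem e) p∣e))))
      where
      lem : ∀ e → e ≡ e - + 0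
      lem = solve-∀

    -- The unknown `+ p * L` in `V-linear` is read off from `B (+ p) (+ 2) n`, which has this
    -- first-order expansion and is also exactly (1^p + 1) w / 2 = w.
    V-at-multiple : ∀ t → V (+ p * t) n ≈ w * (w * (e + t * (+ 1 - e)))
    V-at-multiple t = begin
      V (+ p * t) n                       ≈⟨ V-linear t n ⟩
      w * (w * e + + p * t * L)           ≡⟨ lem₁ w e (+ p) t L ⟩
      w * (w * e + t * (w * e + + p * L - w * e)) ≈⟨ *-congˡ w (+-congˡ (w * e) (*-congˡ t (+-congʳ (- (w * e)) w≈))) ⟨
      w * (w * e + t * (w - w * e))       ≡⟨ lem₂ w e t ⟩
      w * (w * (e + t * (+ 1 - e)))       ∎
      where
      L = B-slope (+ 2) n
      lem₁ : ∀ w e p t L → w * (w * e + p * t * L) ≡ w * (w * e + t * (w * e + p * L - w * e))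
      lem₁ = solve-∀
      lem₂ : ∀ w e t → w * (w * e + t * (w - w * e)) ≡ w * (w * (e + t * (+ 1 - e)))
      lem₂ = solve-∀
      B≡w : B (+ p) (+ 2) n ≡ w
      B≡w = *-cancelˡ-≡ (+ 2) _ _ (trans (B-at-p 1) (cong (λ z → (z + + 1) * w) (^-zeroˡ p)))
      w≈ : w ≈ w * e + + p * L
      w≈ = subst (_≈ w * e + + p * L) B≡w (B-at-p-linear (+ 2))

    -- An affine function of `t` is fixed by its values at 0 and 1; the latter is `oddProd-at-2n+1`.
    oddProd-at-multiple : ∀ t → oddProd (+ p * t) h ≈ K₀ * (+ 1 + t * (e - + 1))
    oddProd-at-multiple t = begin
      oddProd (+ p * t) h                  ≈⟨ oddProd-linear t h ⟩
      K₀ + + p * t * L                     ≡⟨ lem₁ K₀ (+ p) t L ⟩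
      K₀ + t * (K₀ + + p * + 1 * L - K₀)   ≈⟨ +-congˡ K₀ (*-congˡ t (+-congʳ (- K₀) (oddProd-linear (+ 1) h))) ⟨
      K₀ + t * (oddProd (+ p * + 1) h - K₀) ≡⟨ cong (λ z → K₀ + t * (z - K₀)) (trans (cong (λ z → oddProd z h) (*-identityʳ (+ p))) (oddProd-at-2n+1 h)) ⟩
      K₀ + t * (e * K₀ - K₀)               ≡⟨ lem₂ K₀ t e ⟩
      K₀ * (+ 1 + t * (e - + 1))           ∎
      where
      L = oddProd-slope h
      lem₁ : ∀ k p t L → k + p * t * L ≡ k + t * (k + p * + 1 * L - k)
      lem₁ = solve-∀
      lem₂ : ∀ k t e → k + t * (e * k - k) ≡ k * (+ 1 + t * (e - + 1))
      lem₂ = solve-∀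

    Z : ℤ → ℤ
    Z b = pochℤ (+ p * b + + 1) h

    -- With b = (h + 1) t + h one has 2b + 1 = (p + 1) t + p, so the argument 2 p b + 1 of the
    -- `oddProd` is p t - 2h modulo p², and reflection takes it to - p t.
    half-block : ∀ t → c * Z ((H + + 1) * t + H) ≈ s * (K₀ * (+ 1 + - t * (e - + 1)))
    half-block t = begin
      c * Z b                                ≡⟨ oddProd-poch (+ p * b + + 1) h ⟩
      oddProd (+ 2 * (+ p * b + + 1) - + 1) h ≈⟨ oddProd-cong h (mod (t + + 1) (lem₁ H (+ p) t refl)) ⟩
      oddProd (+ p * t - + 2 * H) h          ≡⟨ oddProd-reflect (+ p * t) h ⟩
      s * oddProd (- (+ p * t)) h            ≡⟨ cong (λ z → s * oddProd z h) (lem₂ (+ p) t) ⟩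
      s * oddProd (+ p * - t) h              ≈⟨ *-congˡ s (oddProd-at-multiple (- t)) ⟩
      s * (K₀ * (+ 1 + - t * (e - + 1)))     ∎
      where
      b = (H + + 1) * t + H
      lem₀ : ∀ H t → + 2 * ((+ 1 + (H + H)) * ((H + + 1) * t + H) + + 1) - + 1 ≡
             (+ 1 + (H + H)) * t - + 2 * H + (t + + 1) * ((+ 1 + (H + H)) * (+ 1 + (H + H)))
      lem₀ = solve-∀
      -- The relation P = 1 + 2H enters through `refl`, leaving the solver an identity in `H` and
      -- `t` alone.
      lem₁ : ∀ H P t → P ≡ + 1 + (H + H) →
        + 2 * (P * ((H + + 1) * t + H) + + 1) - + 1 ≡ P * t - + 2 * H + (t + + 1) * (P * P)
      lem₁ H P t refl = lem₀ H t
      lem₂ : ∀ p t → - (p * t) ≡ p * - t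
      lem₂ = solve-∀

    half-block₀ : c * Z H ≈ s * K₀
    half-block₀ = begin
      c * Z H                                 ≡⟨ cong (λ z → c * Z z) (lem₁ H) ⟩
      c * Z ((H + + 1) * + 0 + H)             ≈⟨ half-block (+ 0) ⟩
      s * (K₀ * (+ 1 + - (+ 0) * (e - + 1)))  ≡⟨ lem₂ s K₀ e ⟩
      s * K₀                                  ∎
      where
      lem₁ : ∀ H → H ≡ (H + + 1) * + 0 + H
      lem₁ = solve-∀
      lem₂ : ∀ s k e → s * (k * (+ 1 + - (+ 0) * (e - + 1))) ≡ s * k
      lem₂ = solve-∀

    -- The factors p h + 1, ..., p h + 2h are symmetric about p²/2, so modulo p² the upper half is
    -- `s` times the lower half `Z H`. The whole block is `w` by `block-product`, and `half-block₀`
    -- relates `Z H` to `K₀`.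
    K₀² : K₀ * K₀ ≈ s * (e * w)
    K₀² = begin
      K₀ * K₀                         ≡⟨ lem₃ K₀ s (sgn² h) ⟩
      s * K₀ * (s * K₀)               ≈⟨ *-cong half-block₀ half-block₀ ⟨
      c * Z H * (c * Z H)             ≡⟨ lem₅ c (Z H) s (sgn² h) ⟩
      s * (c * c * (Z H * (s * Z H))) ≡⟨ cong (λ z → s * (z * (Z H * (s * Z H)))) e≡c*c ⟨
      s * (e * (Z H * (s * Z H)))     ≈⟨ *-congˡ s (*-congˡ e (*-congˡ (Z H) upper-half)) ⟨
      s * (e * (Z H * pochℤ (+ p * H + + 1 + H) h)) ≡⟨ cong (λ z → s * (e * z)) (poch-split (+ p * H + + 1) h h) ⟨
      s * (e * pochℤ (+ p * H + + 1) n) ≈⟨ *-congˡ s (*-congˡ e (block-product H)) ⟩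
      s * (e * w)                     ∎
      where
      lem₀ : ∀ H → (+ 1 + (H + H)) * H + + 1 + H ≡ - ((+ 1 + (H + H)) * H + H) + + 1 * ((+ 1 + (H + H)) * (+ 1 + (H + H)))
      lem₀ = solve-∀
      lem₁ : ∀ H P → P ≡ + 1 + (H + H) → P * H + + 1 + H ≡ - (P * H + H) + + 1 * (P * P)
      lem₁ H P refl = lem₀ H
      lem₂ : ∀ k s → s * s * (k * k) ≡ s * k * (s * k)
      lem₂ = solve-∀
      lem₃ : ∀ k s → s * s ≡ + 1 → k * k ≡ s * k * (s * k)
      lem₃ k s eq = trans (sym (*-identityˡ (k * k))) (trans (cong (_* (k * k)) (sym eq)) (lem₂ k s))
      lem₄ : ∀ c z s → s * s * (c * z * (c * z)) ≡ s * (c * c * (z * (s * z)))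
      lem₄ = solve-∀
      lem₅ : ∀ c z s → s * s ≡ + 1 → c * z * (c * z) ≡ s * (c * c * (z * (s * z)))
      lem₅ c z s eq = trans (sym (*-identityˡ (c * z * (c * z)))) (trans (cong (_* (c * z * (c * z))) (sym eq)) (lem₄ c z s))
      upper-half : pochℤ (+ p * H + + 1 + H) h ≈ s * Z H
      upper-half = begin
        pochℤ (+ p * H + + 1 + H) h  ≈⟨ poch-cong h (mod (+ 1) (lem₁ H (+ p) refl)) ⟩
        pochℤ (- (+ p * H + H)) h    ≡⟨ poch-reflect (+ p * H) h ⟩
        s * Z H                      ∎

    -- This is (p² + 1)/2, a representative of 1/2, in the shape required by `Gp-half`.
    m₁ : ℕ
    m₁ = suc (h ℕ.+ p ℕ.* h)

    -- `D` is `den n`, and `σ` is the sign (-1)^((p+1)/2).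
    σ D : ℤ
    σ = - s
    D = w * e * w

    target : ℕ → ℕ → ℤ
    target m₂ m₃ = D * (σ * (Gp p m₁ * Gp p m₂ * Gp p m₃))

    -- Mod p, u = h t and b = (h+1) t + h solve 2u ≡ − t and 2b + 1 ≡ t, and 1 + h + u + b is exactly p (t+1).
    module Base (t : ℕ) where

      b m₂ m₃ : ℕ
      b  = suc h ℕ.* t ℕ.+ h
      m₂ = p ℕ.* (h ℕ.* t)
      m₃ = suc (h ℕ.+ p ℕ.* b)

      T : ℤ
      T = + t

      +b : + b ≡ (H + + 1) * T + H
      +b = trans (cong (λ z → z + H) (pos-* (suc h) t)) (lem H T)
        where
        lem : ∀ H T → (+ 1 + H) * T + H ≡ (H + + 1) * T + H
        lem = solve-∀

      2m₂≈ : + 2 * + m₂ ≈ - (+ p * T)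
      2m₂≈ = mod T (trans (cong (+ 2 *_) (trans (pos-* p (h ℕ.* t)) (cong (+ p *_) (pos-* h t)))) (lem₁ H (+ p) T refl))
        where
        lem₀ : ∀ H T → + 2 * ((+ 1 + (H + H)) * (H * T)) ≡ - ((+ 1 + (H + H)) * T) + T * ((+ 1 + (H + H)) * (+ 1 + (H + H)))
        lem₀ = solve-∀
        lem₁ : ∀ H P T → P ≡ + 1 + (H + H) → + 2 * (P * (H * T)) ≡ - (P * T) + T * (P * P)
        lem₁ H P T refl = lem₀ H T

      2m₃≈ : + 2 * + m₃ ≈ + p * T + + 1
      2m₃≈ = mod (T + + 1) (trans (cong (λ z → + 2 * (+ 1 + (H + z))) (trans (pos-* p b) (cong (+ p *_) +b))) (lem₁ H (+ p) T refl))
        where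
        lem₀ : ∀ H T → + 2 * (+ 1 + (H + (+ 1 + (H + H)) * ((H + + 1) * T + H))) ≡
               (+ 1 + (H + H)) * T + + 1 + (T + + 1) * ((+ 1 + (H + H)) * (+ 1 + (H + H)))
        lem₀ = solve-∀
        lem₁ : ∀ H P T → P ≡ + 1 + (H + H) → + 2 * (+ 1 + (H + P * ((H + + 1) * T + H))) ≡ P * T + + 1 + (T + + 1) * (P * P)
        lem₁ H P T refl = lem₀ H T

      Gp-half : ∀ u → Gp p (suc (h ℕ.+ p ℕ.* u)) ≈ - s * v ^ u * Z (+ u)
      Gp-half u = begin
        Gp p (suc (h ℕ.+ p ℕ.* u))       ≡⟨ Gp-block u h (ℕ.s≤s (ℕ.m≤m+n h h)) ⟩
        - s * Gp p (p ℕ.* u) * Z (+ u)   ≈⟨ *-congʳ (Z (+ u)) (*-congˡ (- s) (Gp-multiples u)) ⟩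
        - s * v ^ u * Z (+ u)            ∎

      v-power : v * (v ^ h * v ^ (h ℕ.* t) * v ^ b) ≈ + 1
      v-power = begin
        v * (v ^ h * v ^ (h ℕ.* t) * v ^ b)  ≡⟨ cong (λ z → v * (z * v ^ b)) (^-distribˡ-+-* v h (h ℕ.* t)) ⟨
        v * (v ^ (h ℕ.+ h ℕ.* t) * v ^ b)    ≡⟨ cong (v *_) (^-distribˡ-+-* v (h ℕ.+ h ℕ.* t) b) ⟨
        v ^ suc (h ℕ.+ h ℕ.* t ℕ.+ b)        ≡⟨ cong (v ^_) (lem h t) ⟩
        v ^ (p ℕ.* suc t)                    ≡⟨ ^-*-assoc v p (suc t) ⟨
        (v ^ p) ^ suc t                      ≈⟨ ^-cong (suc t) v^p ⟩
        (+ 1) ^ suc t                        ≡⟨ ^-zeroˡ (suc t) ⟩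
        + 1                                  ∎
        where
        lem : ∀ h t → suc (h ℕ.+ h ℕ.* t ℕ.+ (suc h ℕ.* t ℕ.+ h)) ≡ suc (h ℕ.+ h) ℕ.* suc t
        lem = ℕ.solve-∀

      G : ℤ
      G = Gp p m₁ * Gp p m₂ * Gp p m₃

      vG≈ : v * G ≈ Z H * Z ((H + + 1) * T + H)
      vG≈ = begin
        v * G
          ≈⟨ *-congˡ v (*-cong (*-cong (Gp-half h) (Gp-multiples (h ℕ.* t))) (Gp-half b)) ⟩
        v * (- s * v ^ h * Z H * v ^ (h ℕ.* t) * (- s * v ^ b * Z (+ b)))
          ≡⟨ lem₁ s v (v ^ h) (v ^ (h ℕ.* t)) (v ^ b) (Z H) (Z (+ b)) ⟩
        s * s * (v * (v ^ h * v ^ (h ℕ.* t) * v ^ b)) * (Z H * Z (+ b))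
          ≈⟨ *-congʳ (Z H * Z (+ b)) (*-congˡ (s * s) v-power) ⟩
        s * s * + 1 * (Z H * Z (+ b))
          ≡⟨ cong₂ (λ x y → x * + 1 * (Z H * Z y)) (sgn² h) +b ⟩
        + 1 * + 1 * (Z H * Z ((H + + 1) * T + H))
          ≡⟨ lem₂ (Z H * Z ((H + + 1) * T + H)) ⟩
        Z H * Z ((H + + 1) * T + H) ∎
        where
        lem₁ : ∀ s v x y z k l → v * (- s * x * k * y * (- s * z * l)) ≡ s * s * (v * (x * y * z)) * (k * l)
        lem₁ = solve-∀
        lem₂ : ∀ x → + 1 * + 1 * x ≡ x
        lem₂ = solve-∀

      δ : ℤ
      δ = + 1 + - T * (e - + 1)

      -- Since e = c², multiplying by `e` gives each half block the power of 2 that `half-block`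
      -- asks for, and `w` with the sign supplies the `v` of `vG≈`. The resulting `K₀ * K₀` returns
      -- the factor `e * w`, which cancels.
      -G≈ : - G ≈ s * δ
      -G≈ = cancel-p² (e * w) (p∤-* p∤e p∤w) (begin
        e * w * - G                                   ≡⟨ lem₁ e w G ⟩
        e * (- w * G)                                 ≈⟨ *-congˡ e vG≈ ⟩
        e * (Z H * Z ((H + + 1) * T + H))             ≡⟨ cong (_* (Z H * Z ((H + + 1) * T + H))) e≡c*c ⟩
        c * c * (Z H * Z ((H + + 1) * T + H))         ≡⟨ lem₂ c (Z H) (Z ((H + + 1) * T + H)) ⟩
        c * Z H * (c * Z ((H + + 1) * T + H))         ≈⟨ *-cong half-block₀ (half-block T) ⟩
        s * K₀ * (s * (K₀ * δ))                       ≡⟨ lem₃ s K₀ δ ⟩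
        s * s * (K₀ * K₀ * δ)                         ≡⟨ cong (_* (K₀ * K₀ * δ)) (sgn² h) ⟩
        + 1 * (K₀ * K₀ * δ)                           ≈⟨ *-congˡ (+ 1) (*-congʳ δ K₀²) ⟩
        + 1 * (s * (e * w) * δ)                       ≡⟨ lem₄ s (e * w) δ ⟩
        e * w * (s * δ)                               ∎)
        where
        lem₁ : ∀ e w G → e * w * - G ≡ e * (- w * G)
        lem₁ = solve-∀
        lem₂ : ∀ c x y → c * c * (x * y) ≡ c * x * (c * y)
        lem₂ = solve-∀
        lem₃ : ∀ s k d → s * k * (s * (k * d)) ≡ s * s * (k * k * d)
        lem₃ = solve-∀
        lem₄ : ∀ s x d → + 1 * (s * x * d) ≡ x * (s * d)
        lem₄ = solve-∀

      V≈target : V (+ p * T) n ≈ target m₂ m₃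
      V≈target = begin
        V (+ p * T) n                                   ≈⟨ V-at-multiple T ⟩
        w * (w * (e + T * (+ 1 - e)))                   ≡⟨ lem₁ w e T ⟩
        D * δ + w * w * T * ((e - + 1) * (e - + 1))     ≈⟨ +-congˡ (D * δ) (*-congˡ (w * w * T) (≈ₚ1⇒[x-1]²≈0 e e≈ₚ1)) ⟩
        D * δ + w * w * T * + 0                         ≡⟨ lem₂ D δ (w * w * T) ⟩
        D * (+ 1 * δ)                                   ≡⟨ cong (λ z → D * (z * δ)) (sgn² h) ⟨
        D * (s * s * δ)                                 ≡⟨ cong (D *_) (*-assoc s s δ) ⟩
        D * (s * (s * δ))                               ≈⟨ *-congˡ D (*-congˡ s -G≈) ⟨
        D * (s * - G)                                   ≡⟨ cong (D *_) (lem₃ s G) ⟩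
        D * (σ * G)                                     ∎
        where
        lem₁ : ∀ w e T → w * (w * (e + T * (+ 1 - e))) ≡ w * e * w * (+ 1 + - T * (e - + 1)) + w * w * T * ((e - + 1) * (e - + 1))
        lem₁ = solve-∀
        lem₂ : ∀ D d x → D * d + x * + 0 ≡ D * (+ 1 * d)
        lem₂ = solve-∀
        lem₃ : ∀ s G → s * - G ≡ - s * G
        lem₃ = solve-∀

    -- The induction from a to a + 2

    -- Consecutive values differ by a multiple of p, as (r+1)_p - (r)_p = p (r+1)_(p-1), and (0)_p =
    -- 0.
    p∣poch-nat : ∀ r → pochℤ (+ r) p Mod-p.≈ + 0
    p∣poch-nat zero    = Mod-p.≡⇒≈ (trans (poch-shift (+ 0) n) (*-zeroˡ (pochℤ (+ 1) n)))
    p∣poch-nat (suc r) = Mod-p.≈-trans (Mod-p.mod y (lem₂ (+ r) (+ n) y eq)) (p∣poch-nat r)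
      where
      y = pochℤ (+ suc r) n
      eq : pochℤ (+ r) p ≡ + r * y
      eq = trans (poch-shift (+ r) n) (cong (λ z → + r * pochℤ z n) (lem (+ r)))
        where
        lem : ∀ r → r + + 1 ≡ + 1 + r
        lem = solve-∀
      lem₁ : ∀ r n y → y * (+ 1 + r + n) ≡ r * y + y * (+ 1 + n)
      lem₁ = solve-∀
      lem₂ : ∀ r n y {z} → z ≡ r * y → y * (+ 1 + r + n) ≡ z + y * (+ 1 + n)
      lem₂ r n y refl = lem₁ r n y

    p∣poch : ∀ x → pochℤ x p Mod-p.≈ + 0
    p∣poch x = Mod-p.≈-trans (Mod-p.poch-cong p (Mod-p.mod (x /ℕ p) (a≡a%ℕn+[a/ℕn]*n x p))) (p∣poch-nat (x %ℕ p))

    ≈ₚ0-* : ∀ {x y} → x Mod-p.≈ + 0 → y Mod-p.≈ + 0 → x * y ≈ + 0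
    ≈ₚ0-* (Mod-p.mod k refl) (Mod-p.mod l refl) = mod (k * l) (lem k l (+ p))
      where
      lem : ∀ k l p → (+ 0 + k * p) * (+ 0 + l * p) ≡ + 0 + k * l * (p * p)
      lem = solve-∀

    -- `W a p` is a product of two Pochhammer symbols of length `p`, each divisible by `p`.
    V-recurrence-mod : ∀ a → ¬ (+ p ∣ a + + 1) → ¬ (+ p ∣ a + + 2) → (a + + 2) * V (a + + 2) n ≈ - ((a + + 1) * V a n)
    V-recurrence-mod a p∤a+1 p∤a+2 = cancel-p² ((a + + 1) * (a + + 2)) (p∤-* p∤a+1 p∤a+2) (begin
      u * x                                     ≡⟨ lem₁ u x y ⟩
      u * (x + y) + u * - y                     ≡⟨ cong (λ z → z + u * - y) (V-recurrence a n) ⟩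
      - (+ 2 * a + + 3) * W a p + u * - y       ≈⟨ +-congʳ (u * - y) (*-congˡ (- (+ 2 * a + + 3)) (≈ₚ0-* (p∣poch (- (a + + 2))) (p∣poch (a + + 1)))) ⟩
      - (+ 2 * a + + 3) * + 0 + u * - y         ≡⟨ lem₂ (- (+ 2 * a + + 3)) (u * - y) ⟩
      u * - y                                   ∎)
      where
      u = (a + + 1) * (a + + 2)
      x = (a + + 2) * V (a + + 2) n
      y = (a + + 1) * V a n
      lem₁ : ∀ u x y → u * x ≡ u * (x + y) + u * - y
      lem₁ = solve-∀
      lem₂ : ∀ k z → k * + 0 + z ≡ z
      lem₂ = solve-∀

    -- The claim for one choice of representatives m₂ ≡ − a/2 and m₃ ≡ (a+1)/2, with m₁ ≡ 1/2 fixed.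
    record HoldsAt (a : ℤ) : Set where
      constructor holds
      field
        m₂ m₃ : ℕ
        2m₂≈  : + 2 * + m₂ ≈ - a
        2m₃≈  : + 2 * + m₃ ≈ a + + 1
        V≈    : V a n ≈ target m₂ m₃

    p∤-half : ∀ {x y} → + 2 * x ≈ y → ¬ (+ p ∣ y) → ¬ (+ p ∣ x)
    p∤-half {x} {y} 2x≈y p∤y p∣x = p∤y (Mod-p.≈0⇒∣ (Mod-p.≈-trans (Mod-p.≈-sym (≈p²⇒≈p 2x≈y))
      (Mod-p.∣⇒≈ (subst (+ p ∣_) (lem (+ 2 * x)) (∣n⇒∣m*n (+ 2) p∣x)))))
      where
      lem : ∀ x → x ≡ x - + 0
      lem = solve-∀

    -- The series gains the factor -(a+1)/(a+2). So does the Gamma product: raising `m₃` by one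
    -- multiplies by -m₃ ≡ -(a+1)/2, and lowering `m₂` to `M` divides by -M ≡ (a+2)/2.
    holds-step : ∀ a → ¬ (+ p ∣ a + + 1) → ¬ (+ p ∣ a + + 2) → HoldsAt a → HoldsAt (a + + 2)
    holds-step a p∤a+1 p∤a+2 (holds m₂ m₃ 2m₂≈ 2m₃≈ V≈) = record
      { m₂   = M
      ; m₃   = suc m₃
      ; 2m₂≈ = 2M≈
      ; 2m₃≈ = ≈-trans (≡⇒≈ (lem₁ (+ m₃))) (≈-trans (+-congʳ (+ 2) 2m₃≈) (≡⇒≈ (lem₂ a)))
      ; V≈   = cancel-p² (a + + 2) p∤a+2 (begin
          (a + + 2) * V (a + + 2) n                    ≈⟨ V-recurrence-mod a p∤a+1 p∤a+2 ⟩
          - ((a + + 1) * V a n)                        ≈⟨ neg-cong (*-cong (≈-sym 2m₃≈) V≈) ⟩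
          - (+ 2 * + m₃ * (D * (σ * (g₁ * Gp p m₂ * Gp p m₃))))
            ≈⟨ neg-cong (*-congˡ (+ 2 * + m₃) (*-congˡ D (*-congˡ σ (*-congʳ (Gp p m₃) (*-congˡ g₁ Gp-M))))) ⟩
          - (+ 2 * + m₃ * (D * (σ * (g₁ * (- (+ M) * Gp p M) * Gp p m₃))))
            ≡⟨ lem₃ (+ m₃) D σ g₁ (+ M) (Gp p M) (Gp p m₃) ⟩
          - (+ 2 * + M) * (D * (σ * (g₁ * Gp p M * (- (+ m₃) * Gp p m₃))))
            ≈⟨ *-congʳ _ (neg-cong 2M≈) ⟩
          - - (a + + 2) * (D * (σ * (g₁ * Gp p M * (- (+ m₃) * Gp p m₃))))
            ≡⟨ cong₂ (λ x y → x * (D * (σ * (g₁ * Gp p M * y)))) (lem₄ a) (sym (Gp-unit m₃ (λ p∣ → p∤-half 2m₃≈ p∤a+1 (∣ᵤ⇒∣ p∣)))) ⟩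
          (a + + 2) * target M (suc m₃)                ∎)
      }
      where
      g₁ = Gp p m₁
      M : ℕ
      -- This is m₂ + p² - 1, a representative of m₂ - 1 without truncated subtraction.
      M = m₂ ℕ.+ (n ℕ.+ n ℕ.* p)
      1+M : suc M ≡ m₂ ℕ.+ p ℕ.* p
      1+M = sym (ℕ.+-suc m₂ (n ℕ.+ n ℕ.* p))
      lem₁ : ∀ m → + 2 * (+ 1 + m) ≡ + 2 * m + + 2
      lem₁ = solve-∀
      lem₂ : ∀ a → a + + 1 + + 2 ≡ a + + 2 + + 1
      lem₂ = solve-∀
      lem₃ : ∀ m D σ g M x y → - (+ 2 * m * (D * (σ * (g * (- M * x) * y)))) ≡ - (+ 2 * M) * (D * (σ * (g * x * (- m * y))))
      lem₃ = solve-∀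
      lem₄ : ∀ a → - - (a + + 2) ≡ a + + 2
      lem₄ = solve-∀
      lem₅ : ∀ x M m q → + 1 + M ≡ m + q → + 2 * m ≡ x → + 2 * M ≡ x - + 2 + + 2 * q
      lem₅ x M m q eq refl = trans (lem M) (trans (cong (λ z → + 2 * z - + 2) eq) (lem′ m q))
        where
        lem : ∀ M → + 2 * M ≡ + 2 * (+ 1 + M) - + 2
        lem = solve-∀
        lem′ : ∀ m q → + 2 * (m + q) - + 2 ≡ + 2 * m - + 2 + + 2 * q
        lem′ = solve-∀
      lem₆ : ∀ a → - a - + 2 ≡ - (a + + 2)
      lem₆ = solve-∀
      2M≈ : + 2 * + M ≈ - (a + + 2)
      2M≈ = ≈-trans (mod (+ 2) (lem₅ _ (+ M) (+ m₂) (+ p * + p) (trans (cong +_ 1+M) (cong (λ z → + m₂ + z) (pos-* p p))) refl))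
        (≈-trans (+-congʳ (- (+ 2)) 2m₂≈) (≡⇒≈ (lem₆ a)))
      p∤M : ¬ p ℕ.∣ M
      p∤M p∣M = p∤-half 2M≈ (λ p∣ → p∤a+2 (subst (+ p ∣_) (lem₄ a) (∣m⇒∣-m p∣))) (∣ᵤ⇒∣ p∣M)
      Gp-M : Gp p m₂ ≈ - (+ M) * Gp p M
      Gp-M = begin
        Gp p m₂                 ≈⟨ Gp-periodic m₂ ⟨
        Gp p (m₂ ℕ.+ p ℕ.* p)   ≡⟨ cong (Gp p) 1+M ⟨
        Gp p (suc M)            ≡⟨ Gp-unit M p∤M ⟩
        - (+ M) * Gp p M        ∎

    p∤multiple+ : ∀ t k → .{{ℕ.NonZero k}} → k ℕ.< p → ¬ (+ p ∣ + p * t + + k)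
    p∤multiple+ t k k<p (divides l eq) = p∤small k<p (divides (l - t) (lem (+ p) t (+ k) l eq))
      where
      lem₀ : ∀ P t k → k ≡ P * t + k - t * P
      lem₀ = solve-∀
      lem₁ : ∀ P t l → l * P - t * P ≡ (l - t) * P
      lem₁ = solve-∀
      lem : ∀ P t k l → P * t + k ≡ l * P → k ≡ (l - t) * P
      lem P t k l eq = trans (lem₀ P t k) (trans (cong (λ z → z - t * P) eq) (lem₁ P t l))

    -- Starting from `p * t`, steps of two reach the residues 0, 2, ..., 2h = p - 1 without a + 1 or
    -- a + 2 becoming a multiple of `p`. This is where evenness of the residue enters.
    holds-all : ∀ t j → j ℕ.≤ h → HoldsAt (+ p * + t + + (j ℕ.+ j))
    holds-all t zero    _   = subst HoldsAt (lem (+ p * + t)) (record { m₂ = m₂ ; m₃ = m₃ ; 2m₂≈ = 2m₂≈ ; 2m₃≈ = 2m₃≈ ; V≈ = V≈target })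
      where
      open Base t
      lem : ∀ x → x ≡ x + + 0
      lem = solve-∀
    holds-all t (suc j) j<h = subst HoldsAt (trans (lem₂ (+ p * + t) (+ (j ℕ.+ j))) (cong (λ z → + p * + t + + suc z) (sym (ℕ.+-suc j j))))
      (holds-step (+ p * + t + + (j ℕ.+ j))
        (λ p∣ → p∤multiple+ (+ t) (suc (j ℕ.+ j)) (ℕ.<-trans ℕ.≤-refl 2+2j<p) (subst (+ p ∣_) (lem₁ (+ p * + t) (+ (j ℕ.+ j))) p∣))
        (λ p∣ → p∤multiple+ (+ t) (suc (suc (j ℕ.+ j))) 2+2j<p (subst (+ p ∣_) (lem₂ (+ p * + t) (+ (j ℕ.+ j))) p∣))
        (holds-all t j (ℕ.<⇒≤ j<h)))
      where
      lem₁ : ∀ x j → x + j + + 1 ≡ x + (+ 1 + j)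
      lem₁ = solve-∀
      lem₂ : ∀ x j → x + j + + 2 ≡ x + (+ 1 + (+ 1 + j))
      lem₂ = solve-∀
      2+2j<p : suc (suc (j ℕ.+ j)) ℕ.< p
      2+2j<p = ℕ.s≤s (subst (ℕ._≤ n) (cong suc (ℕ.+-suc j j)) (ℕ.+-mono-≤ j<h j<h))

    -- Return to the stated congruence

    p^2 : + (p ℕ.^ 2) ≡ + p * + p
    p^2 = trans (cong (λ z → + (p ℕ.* z)) (ℕ.*-identityʳ p)) (pos-* p p)

    modℤ⇒≈ : ∀ x y → x ≡ y [modℤ p ℕ.^ 2 ] → x ≈ y
    modℤ⇒≈ x y x≡y = ∣⇒≈ (subst (_∣ x - y) p^2 (∣ᵤ⇒∣ x≡y))

    -- As 2 is invertible modulo p², the doubled congruence determines the argument modulo p², so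
    -- the choice of representatives is immaterial.
    Gp-cong-half : ∀ m m′ {y} → + 2 * + m ≈ y → + 2 * + m′ ≈ y → Gp p m ≈ Gp p m′
    Gp-cong-half m m′ 2m≈y 2m′≈y = Gp-cong {m} {m′} (cancel-p² (+ 2) (p∤small (ℕ.s≤s 2≤n)) (≈-trans 2m≈y (≈-sym 2m′≈y)))

    2m₁≈1 : + 2 * + m₁ ≈ + 1
    2m₁≈1 = mod (+ 1) (trans (cong (λ z → + 2 * (+ 1 + (H + z))) (pos-* p h)) (lem₁ H (+ p) refl))
      where
      lem₀ : ∀ H → + 2 * (+ 1 + (H + (+ 1 + (H + H)) * H)) ≡ + 1 + + 1 * ((+ 1 + (H + H)) * (+ 1 + (H + H)))
      lem₀ = solve-∀
      lem₁ : ∀ H P → P ≡ + 1 + (H + H) → + 2 * (+ 1 + (H + P * H)) ≡ + 1 + + 1 * (P * P)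
      lem₁ H P refl = lem₀ H

    V≈Gp : ∀ {a} → HoldsAt a → ∀ m₁′ m₂′ m₃′ →
      + 2 * + m₁′ ≈ + 1 → + 2 * + m₂′ ≈ - a → + 2 * + m₃′ ≈ a + + 1 →
      V a n ≈ D * (σ * (Gp p m₁′ * Gp p m₂′ * Gp p m₃′))
    V≈Gp (holds m₂ m₃ 2m₂≈ 2m₃≈ V≈) m₁′ m₂′ m₃′ e₁ e₂ e₃ = ≈-trans V≈
      (*-congˡ D (*-congˡ σ (*-cong (*-cong (Gp-cong-half m₁ m₁′ 2m₁≈1 e₁) (Gp-cong-half m₂ m₂′ 2m₂≈ e₂)) (Gp-cong-half m₃ m₃′ 2m₃≈ e₃))))

    -- The difference is represented by (V - R D)/D, so `D` times its reduced numerator is a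
    -- multiple of V - R D, and `D` is prime to `p`.
    p²∣numerator : ∀ a R → V a n ≈ D * R → ↥ (F-trunc p a ℚ.- (R ℚ./ 1)) ≈ + 0
    p²∣numerator a R V≈DR = go (+-represents (sum-represents a n) (neg-represents (/-represents R 1)))
      where
      x : ℚ
      x = F-trunc p a ℚ.- (R ℚ./ 1)
      lem₁ : ∀ d u → d * u ≡ u * (d * + 1)
      lem₁ = solve-∀
      lem₂ : ∀ D R y → (D * R * + 1 + - R * D) * y ≡ D * + 0
      lem₂ = solve-∀
      go : Represents x (V a n * + 1 + - R * + den n) (+ den n * + 1) → ↥ x ≈ + 0
      go (represents eq) = cancel-p² D (p∤-* (p∤-* p∤w p∤e) p∤w) (begin
        D * ↥ x                                 ≡⟨ lem₁ D (↥ x) ⟩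
        ↥ x * (D * + 1)                         ≡⟨ cong (λ z → ↥ x * (z * + 1)) (den-product n) ⟨
        ↥ x * (+ den n * + 1)                   ≡⟨ eq ⟩
        (V a n * + 1 + - R * + den n) * ↧ x     ≡⟨ cong (λ z → (V a n * + 1 + - R * z) * ↧ x) (den-product n) ⟩
        (V a n * + 1 + - R * D) * ↧ x           ≈⟨ *-congʳ (↧ x) (+-congʳ (- R * D) (*-congʳ (+ 1) V≈DR)) ⟩
        (D * R * + 1 + - R * D) * ↧ x           ≡⟨ lem₂ D R (↧ x) ⟩
        D * + 0                                 ∎)

    modℚ : ∀ x y → ↥ (x ℚ.- y) ≈ + 0 → x ≡ y [modℚ p ²]
    modℚ x y num≈0 =
      ∣⇒∣ᵤ (subst (_∣ ↥ (x ℚ.- y)) (sym p^2) (≈0⇒∣ num≈0)) ,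
      ¬∣denominator p (x ℚ.- y) (λ p≡1 → ℕ.<⇒≢ (ℕ.s≤s (ℕ.≤-trans (ℕ.n≤1+n 1) 2≤n)) (sym p≡1)) (Mod-p.≈0⇒∣ (≈p²⇒≈p num≈0))

    residue : ∀ A r → r ℕ.< p → + A Mod-p.≈ + r → ∃ λ t → + A ≡ + p * + t + + r
    residue A r r<p (Mod-p.mod (+ t) eq) = t , trans eq (lem (+ r) (+ t) (+ p))
      where
      lem : ∀ r t p → r + t * p ≡ p * t + r
      lem = solve-∀
    -- A negative quotient would give r = A + (t + 1) p ≥ p.
    residue A r r<p (Mod-p.mod -[1+ t ] eq) = contradiction (ℕ.≤-trans (ℕ.≤-trans (ℕ.m≤m+n p (t ℕ.* p)) (ℕ.m≤n+m _ A)) (ℕ.≤-reflexive (sym r≡))) (ℕ.<⇒≱ r<p)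
      where
      lem : ∀ r t p → r ≡ r + - t * p + t * p
      lem = solve-∀
      r≡ : r ≡ A ℕ.+ suc t ℕ.* p
      r≡ = +-injective (trans (lem (+ r) (+ suc t) (+ p)) (trans (cong (λ z → z + + suc t * + p) (sym eq)) (cong (λ z → + A + z) (sym (pos-* (suc t) p)))))

    half-bound : ∀ j → j ℕ.+ j ℕ.< p → j ℕ.≤ h
    half-bound j 2j<p = ℕ.≮⇒≥ λ h<j → ℕ.<⇒≱ (ℕ.+-mono-< h<j h<j) (ℕ.≤-pred 2j<p)

    module _ (a : ℤ[ p ]) where
      open ℤ[_] a

      A≈⟨a⟩ : ∀ A → + A ≈ + res 2 → + A Mod-p.≈ + ⟨ a ⟩
      A≈⟨a⟩ A A≈ = Mod-p.≈-trans (≈p²⇒≈p A≈) (Mod-p.∣⇒≈ (subst (λ z → + z ∣ + res 2 - + res 1) (ℕ.*-identityʳ p) (∣ᵤ⇒∣ (res-coh 1))))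

      ⟨a⟩<p : ⟨ a ⟩ ℕ.< p
      ⟨a⟩<p = subst (⟨ a ⟩ ℕ.<_) (ℕ.*-identityʳ p) (res-lt 1)

      holds-at : ∀ A → 2 ℕ.∣ ⟨ a ⟩ → + A ≈ + res 2 → HoldsAt (+ A)
      holds-at A (ℕ.divides j ⟨a⟩≡j*2) A≈ = from (residue A (j ℕ.+ j) 2j<p (subst (λ z → + A Mod-p.≈ + z) ⟨a⟩≡2j (A≈⟨a⟩ A A≈)))
        where
        lem : ∀ j → j ℕ.* 2 ≡ j ℕ.+ j
        lem = ℕ.solve-∀
        ⟨a⟩≡2j : ⟨ a ⟩ ≡ j ℕ.+ j
        ⟨a⟩≡2j = trans ⟨a⟩≡j*2 (lem j)
        2j<p : j ℕ.+ j ℕ.< p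
        2j<p = subst (ℕ._< p) ⟨a⟩≡2j ⟨a⟩<p
        from : (∃ λ t → + A ≡ + p * + t + + (j ℕ.+ j)) → HoldsAt (+ A)
        from (t , eq) = subst HoldsAt (sym eq) (holds-all t j (half-bound j 2j<p))

    sign≡σ : sgn ((p ℕ.+ 1) ℕ./ 2) ≡ σ
    sign≡σ = cong sgn (trans (ℕ./-congˡ {o = 2} (lem h)) (ℕ.m*n/n≡m (suc h) 2))
      where
      lem : ∀ h → suc (h ℕ.+ h) ℕ.+ 1 ≡ suc h ℕ.* 2
      lem = ℕ.solve-∀

    conclusion : (a : ℤ[ p ]) → 2 ℕ.∣ ⟨ a ⟩ → ∀ A m₁′ m₂′ m₃′ →
      (+ A) ≡ (+ ℤ[_].res a 2) [modℤ p ℕ.^ 2 ] →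
      (+ (2 ℕ.* m₁′)) ≡ (+ 1) [modℤ p ℕ.^ 2 ] →
      (+ (2 ℕ.* m₂′ ℕ.+ A)) ≡ (+ 0) [modℤ p ℕ.^ 2 ] →
      (+ (2 ℕ.* m₃′)) ≡ (+ (A ℕ.+ 1)) [modℤ p ℕ.^ 2 ] →
      F-trunc p (+ A) ≡ ((sgn ((p ℕ.+ 1) ℕ./ 2) * (Gp p m₁′ * Gp p m₂′ * Gp p m₃′)) ℚ./ 1) [modℚ p ²]
    conclusion a 2∣⟨a⟩ A m₁′ m₂′ m₃′ A≡ ≡₁ ≡₂ ≡₃ =
      subst (λ z → F-trunc p (+ A) ≡ ((z * (Gp p m₁′ * Gp p m₂′ * Gp p m₃′)) ℚ./ 1) [modℚ p ²]) (sym sign≡σ)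
        (modℚ (F-trunc p (+ A)) (R ℚ./ 1) (p²∣numerator (+ A) R (V≈Gp (holds-at a A 2∣⟨a⟩ (modℤ⇒≈ (+ A) (+ ℤ[_].res a 2) A≡)) m₁′ m₂′ m₃′ e₁ e₂ e₃)))
      where
      R = σ * (Gp p m₁′ * Gp p m₂′ * Gp p m₃′)
      lem : ∀ x y → x ≡ x + y + - y
      lem = solve-∀
      lem′ : ∀ y → + 0 + - y ≡ - y
      lem′ = solve-∀
      e₁ : + 2 * + m₁′ ≈ + 1
      e₁ = subst (_≈ + 1) (pos-* 2 m₁′) (modℤ⇒≈ (+ (2 ℕ.* m₁′)) (+ 1) ≡₁)
      e₂ : + 2 * + m₂′ ≈ - (+ A)
      e₂ = begin
        + 2 * + m₂′                    ≡⟨ pos-* 2 m₂′ ⟨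
        + (2 ℕ.* m₂′)                  ≡⟨ lem (+ (2 ℕ.* m₂′)) (+ A) ⟩
        + (2 ℕ.* m₂′ ℕ.+ A) + - (+ A)  ≈⟨ +-congʳ (- (+ A)) (modℤ⇒≈ (+ (2 ℕ.* m₂′ ℕ.+ A)) (+ 0) ≡₂) ⟩
        + 0 + - (+ A)                  ≡⟨ lem′ (+ A) ⟩
        - (+ A)                        ∎
      e₃ : + 2 * + m₃′ ≈ + A + + 1
      e₃ = subst (_≈ + A + + 1) (pos-* 2 m₃′) (modℤ⇒≈ (+ (2 ℕ.* m₃′)) (+ (A ℕ.+ 1)) ≡₃)

  -- Writing the prime as 2h + 1

  parity : ∀ n → (∃ λ k → n ≡ k ℕ.+ k) ⊎ (∃ λ k → n ≡ suc (k ℕ.+ k))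
  parity zero = inj₁ (0 , refl)
  parity (suc n) with parity n
  ... | inj₁ (k , refl) = inj₂ (k , refl)
  ... | inj₂ (k , refl) = inj₁ (suc k , cong suc (sym (ℕ.+-suc k k)))

  odd-prime : ∀ p → Prime p → p ℕ.≥ 5 → ∃ λ h → 0 ℕ.< h × p ≡ suc (h ℕ.+ h)
  odd-prime p p-prime p≥5 with parity p
  ... | inj₁ (k , p≡2k) = contradiction (prime⇒irreducible p-prime (ℕ.divides k (trans p≡2k (lem k)))) λ
    { (inj₁ ()) ; (inj₂ refl) → contradiction p≥5 λ { (ℕ.s≤s (ℕ.s≤s ())) } }
    where
    lem : ∀ k → k ℕ.+ k ≡ k ℕ.* 2
    lem = ℕ.solve-∀
  ... | inj₂ (zero  , refl) = contradiction p≥5 λ { (ℕ.s≤s ()) }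
  ... | inj₂ (suc k , p≡)   = suc k , ℕ.s≤s ℕ.z≤n , p≡

open import Data.Nat using (ℕ; _≥_; _^_; _*_; _+_; _/_)
open import Data.Nat.Divisibility using (_∣_)
open import Data.Nat.Primality using (Prime)
open import Data.Integer as ℤ using (ℤ; +_; -_)
open import Data.Rational as ℚ using (ℚ)
open import Data.Product using (∃; _,_)
open import Relation.Binary.PropositionalEquality using (refl)

theorem1 : (p : ℕ) → Prime p → p ≥ 5 → (a : ℤ[ p ]) → 2 ∣ ⟨ a ⟩ →
    ∃ λ N → (A m₁ m₂ m₃ : ℕ) →
    (+ A) ≡ (+ ℤ[_].res a N) [modℤ p ^ N ] →
    (+ (2 * m₁)) ≡ (+ 1) [modℤ p ^ N ] →
    (+ (2 * m₂ + A)) ≡ (+ 0) [modℤ p ^ N ] →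
    (+ (2 * m₃)) ≡ (+ (A + 1)) [modℤ p ^ N ] →
    F-trunc p (+ A)
    ≡ ((sgn ((p + 1) / 2) ℤ.* (Gp p m₁ ℤ.* Gp p m₂ ℤ.* Gp p m₃)) ℚ./ 1)
    [modℚ p ²]
theorem1 p p-prime p≥5 with Development.odd-prime p p-prime p≥5
-- Precision 2 suffices: residues modulo p² determine ⟨ a ⟩ and the three `Gp` values modulo p².
-- Matching on `refl` turns the prime into `suc (h + h)`.
... | h , 0<h , refl = λ a 2∣⟨a⟩ → 2 , Development.OddPrime.conclusion h 0<h p-prime a 2∣⟨a⟩
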